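{- Let $a,b,n$ be positive integers with $a>b$, and define the truncated $q$-trinomial coefficient \[ \bigg(\!\!\binom{an}{bn}\!\!\bigg)_q'=\sum_{k=0}^{\lfloor n/2\rfloor}q^{k(k+bn)}\begin{bmatrix} an\\ k\end{bmatrix}\begin{bmatrix} an-k\\ bn+k\end{bmatrix}. \] Then \[ \bigg(\!\!\binom{an}{bn}\!\!\bigg)_q'\equiv\begin{bmatrix} an\\ bn\end{bmatrix}\Big\{1-(a-b)\big(1-\theta_n(q)\big)\Big\}\pmod{\Phi_n(q)^2}, \] where \[ \theta_n(q)=\begin{cases} (-1)^m(1+q^m)q^{m(3m-1)/2}, &\text{if } n=3m,\\ (-1)^mq^{m(3m+1)/2}, &\text{if } n=3m+1,\\ (-1)^{m+1}q^{(m+1)(3m+2)/2}, &\text{if } n=3m+2.\end{cases} \]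
   Context: For integers $n,m$, the $q$-binomial coefficient is $\begin{bmatrix} n\\ m\end{bmatrix}=\begin{bmatrix} n\\ m\end{bmatrix}_q=\frac{(1-q^n)(1-q^{n-1})\cdots(1-q^{n-m+1})}{(1-q)(1-q^2)\cdots(1-q^m)}$ if $0\le m\le n$, and $0$ otherwise. $\Phi_n(q)$ denotes the $n$-th cyclotomic polynomial. $\lfloor x\rfloor$ is the integer part of $x$. For rational functions $A(q),B(q)$, $A\equiv B\pmod{\Phi_n(q)^2}$ means $A-B=\Phi_n(q)^2P(q)/Q(q)$ with $P,Q\in\mathbb{Z}[q]$ and $Q$ coprime to $\Phi_n(q)$. -}

module Defs where

open import Data.Integer as ℤ using (ℤ; +_; 0ℤ; 1ℤ; -1ℤ)
open import Data.Nat as ℕ using (ℕ; zero; suc; _∸_; _≤?_)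
open import Data.Nat.Divisibility using (_∣?_)
open import Data.List using (List; []; _∷_; length; replicate; reverse; _++_; dropWhile; filter; foldr; map)
open import Data.List.Relation.Unary.All using (All)
open import Data.Product using (_×_; _,_; proj₁; proj₂; Σ; ∃)
open import Relation.Binary.PropositionalEquality using (_≡_; _≢_)
open import Relation.Nullary using (yes; no)

-- Polynomials in ℤ[q], as little-endian coefficient lists
-- (the list a₀ ∷ a₁ ∷ … represents a₀ + a₁ q + …).

Poly : Set
Poly = List ℤ

infixl 6 _⊕_ _⊖_
infixl 7 _⊗_

_⊕_ : Poly → Poly → Poly
[] ⊕ q = q
(a ∷ p) ⊕ [] = a ∷ p
(a ∷ p) ⊕ (b ∷ q) = (a ℤ.+ b) ∷ (p ⊕ q)

scale : ℤ → Poly → Poly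
scale c = map (c ℤ.*_)

_⊗_ : Poly → Poly → Poly
[] ⊗ q = []
(a ∷ p) ⊗ q = scale a q ⊕ (0ℤ ∷ (p ⊗ q))

_⊖_ : Poly → Poly → Poly
p ⊖ q = p ⊕ scale -1ℤ q

const : ℤ → Poly
const c = c ∷ []

X^ : ℕ → Poly
X^ k = replicate k 0ℤ ++ (1ℤ ∷ [])

-- polynomial equality (coefficientwise, ignoring trailing zeros)
IsZero : Poly → Set
IsZero p = All (_≡ 0ℤ) p

infix 4 _≈_
_≈_ : Poly → Poly → Set
p ≈ q = IsZero (p ⊖ q)

norm : Poly → Poly
norm p = reverse (dropWhile (ℤ._≟ 0ℤ) (reverse p))

leadCoeff : Poly → ℤ
leadCoeff p with reverse p
... | [] = 0ℤ
... | c ∷ _ = c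

divMonic : ℕ → Poly → Poly → Poly
divMonic zero p d = []
divMonic (suc f) p d with norm p
... | p' with length d ≤? length p'
...   | no _ = []
...   | yes _ = let s = length p' ∸ length d
                    c = leadCoeff p'
                in scale c (X^ s) ⊕ divMonic f (p' ⊖ scale c (X^ s ⊗ d)) d

-- Cyclotomic polynomials, via  q^n - 1 = ∏_{d ∣ n} Φ_d(q).
-- cycList k = [(1 , Φ₁) , … , (k , Φ_k)]

cycList : ℕ → List (ℕ × Poly)
cycList zero = []
cycList (suc k) =
  let prev = cycList k
      n    = suc k
      dprod = foldr (λ e acc → proj₂ e ⊗ acc) (const 1ℤ)
                    (filter (λ e → proj₁ e ∣? n) prev)
      Φn   = divMonic (suc (suc n)) (X^ n ⊖ const 1ℤ) (norm dprod)
  in prev ++ ((n , Φn) ∷ [])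

lastPoly : List (ℕ × Poly) → Poly
lastPoly [] = []
lastPoly (e ∷ []) = proj₂ e
lastPoly (_ ∷ e ∷ es) = lastPoly (e ∷ es)

-- Φ_n(q) (for n ≥ 1)
cyclo : ℕ → Poly
cyclo n = norm (lastPoly (cycList n))

RatFun : Set
RatFun = Poly × Poly

fromPoly : Poly → RatFun
fromPoly p = (p , const 1ℤ)

infixl 6 _+ʳ_ _-ʳ_
infixl 7 _*ʳ_

_+ʳ_ : RatFun → RatFun → RatFun
(a , b) +ʳ (c , d) = (a ⊗ d ⊕ c ⊗ b , b ⊗ d)

_-ʳ_ : RatFun → RatFun → RatFun
(a , b) -ʳ (c , d) = (a ⊗ d ⊖ c ⊗ b , b ⊗ d)

_*ʳ_ : RatFun → RatFun → RatFun
(a , b) *ʳ (c , d) = (a ⊗ c , b ⊗ d)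

-- Q is coprime to F in ℤ[q]  (no common non-constant factor):
-- some ℤ[q]-combination equals a nonzero constant.
Coprime : Poly → Poly → Set
Coprime Q F = Σ Poly λ U → Σ Poly λ V → Σ ℤ λ c → (c ≢ 0ℤ) × (U ⊗ Q ⊕ V ⊗ F ≈ const c)

-- A ≡ B (mod F²):  A - B = F² P / Q with P, Q ∈ ℤ[q], Q coprime to F.
-- Writing A - B = N / E, this means N·Q = F²·P·E.
CongSq : Poly → RatFun → RatFun → Set
CongSq F A B with A -ʳ B
... | (N , E) = Σ Poly λ P → Σ Poly λ Q → Coprime Q F × (N ⊗ Q ≈ F ⊗ F ⊗ P ⊗ E)

qNum : ℕ → ℕ → Poly
qNum n zero = const 1ℤ
qNum n (suc m) = qNum n m ⊗ (const 1ℤ ⊖ X^ (n ∸ m))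

qDen : ℕ → Poly
qDen zero = const 1ℤ
qDen (suc m) = qDen m ⊗ (const 1ℤ ⊖ X^ (suc m))

qbinom : ℕ → ℕ → RatFun
qbinom n m with m ≤? n
... | yes _ = (qNum n m , qDen m)
... | no _  = ([] , const 1ℤ)

sumʳ : ℕ → (ℕ → RatFun) → RatFun
sumʳ zero f = f 0
sumʳ (suc N) f = sumʳ N f +ʳ f (suc N)

truncTri : ℕ → ℕ → ℕ → RatFun
truncTri a b n =
  sumʳ (n ℕ./ 2) λ k →
    fromPoly (X^ (k ℕ.* (k ℕ.+ b ℕ.* n)))
      *ʳ qbinom (a ℕ.* n) k
      *ʳ qbinom (a ℕ.* n ∸ k) (b ℕ.* n ℕ.+ k)

thetaAux : ℕ → ℕ → Poly
thetaAux m zero =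
  scale (-1ℤ ℤ.^ m) ((const 1ℤ ⊕ X^ m) ⊗ X^ ((m ℕ.* (3 ℕ.* m ∸ 1)) ℕ./ 2))
thetaAux m (suc zero) =
  scale (-1ℤ ℤ.^ m) (X^ ((m ℕ.* (3 ℕ.* m ℕ.+ 1)) ℕ./ 2))
thetaAux m (suc (suc _)) =
  scale (-1ℤ ℤ.^ suc m) (X^ ((suc m ℕ.* (3 ℕ.* m ℕ.+ 2)) ℕ./ 2))

theta : ℕ → Poly
theta n = thetaAux (n ℕ./ 3) (n ℕ.% 3)

rhs : ℕ → ℕ → ℕ → RatFun
rhs a b n =
  qbinom (a ℕ.* n) (b ℕ.* n)
    *ʳ fromPoly (const 1ℤ ⊖ scale (+ a ℤ.- + b) (const 1ℤ ⊖ theta n))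

{-# OPTIONS --safe #-}
module Submission where

-- Write c = a - b. For k ≥ 1 the k-th summand of the truncated trinomial
-- coefficient equals [an, bn] times
--   q^(k(k+bn)) ∏_{j<2k} (1 - q^(cn-j)) / ((q;q)_k ∏_{1≤j≤k} (1 - q^(bn+j))),
-- which contains the single factor 1 - q^(cn) ≡ c (1 - qⁿ) mod (1 - qⁿ)².
-- Reducing all other factors by qⁿ ≡ 1 and reflecting q^(n-j) to q^(-j) turns
-- it, modulo Φₙ², into c times the k-th summand of
--   θₙ = ∑ₖ (-1)ᵏ q^(k(k-1)/2) (1 - qⁿ)/(1 - qⁿ⁻ᵏ) [n-k, k],
-- a finite form of the pentagonal number theorem which holds exactly. Only two
-- facts about Φₙ enter: it divides 1 - qⁿ, and it is coprime to 1 - qʲ when n ∤ j.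

open import Algebra.Bundles using (CommutativeRing)
import Algebra.Solver.Ring as RingSolver
open import Algebra.Solver.Ring.AlmostCommutativeRing
  using (fromCommutativeRing; _-Raw-AlmostCommutative⟶_)
open import Data.Empty using (⊥-elim)
open import Data.Integer as ℤ using (ℤ; +_; 0ℤ; 1ℤ; -1ℤ)
import Data.Integer.Properties as ℤₚ
open import Data.Integer.Solver using () renaming (module +-*-Solver to ℤ-Solver)
open import Data.List using
  (List; []; _∷_; _++_; _∷ʳ_; length; reverse; dropWhile; takeWhile; filter; foldr; initLast; _∷ʳ′_)
import Data.List.Properties as Listₚ
open import Data.List.Relation.Binary.Permutation.Propositional using (↭-sym)
open import Data.List.Relation.Binary.Permutation.Propositional.Properties using (All-resp-↭; ↭-reverse)
open import Data.List.Relation.Unary.All using ([]; _∷_)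
import Data.List.Relation.Unary.All.Properties as Allₚ
import Data.Maybe as Maybe
open import Data.Maybe.Relation.Unary.All using (just)
open import Data.Nat as ℕ using (ℕ; zero; suc; _∸_; _≤_; _<_; _≤?_; z≤n; s≤s; z<s; s<s)
import Data.Nat.DivMod as ℕ/
open import Data.Nat.Divisibility
  using (_∣_; divides; _∣?_; ∣⇒≤; ∣-refl; ∣-trans; ∣m+n∣m⇒∣n; n∣m*n)
open import Data.Nat.GCD using (module Bézout; module GCD)
import Data.Nat.Properties as ℕₚ
open import Data.Nat.Solver using (module +-*-Solver)
open import Data.Product using (_×_; _,_; proj₁; proj₂; ∃-syntax)
open import Data.Sum using (_⊎_; inj₁; inj₂)
open import Function using (_∘_)
open import Level using (0ℓ; _⊔_)
open import Relation.Binary.Definitions using (tri<; tri≈; tri>)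
open import Relation.Binary.PropositionalEquality as ≡
  using (_≡_; _≢_; cong; cong₂; subst)
import Relation.Binary.Reasoning.Setoid as SetoidReasoning
open import Relation.Nullary using (¬_; yes; no)
open import Relation.Nullary.Decidable using (dec⇒maybe)

-- q-series identities over a commutative ring

-- No quotient is ever formed. Gaussian polynomials come from the q-Pascal rule, every rational
-- function of the statement is shown to represent a polynomial, and denominators are multiplied out
-- and cancelled, each 1 - qʲ with j ≥ 1 being a non-zero-divisor. Comparing two summands becomes a
-- polynomial identity whose right side is a multiple of (1 - qⁿ)²: one factor 1 - qⁿ is explicit in
-- both cleared summands, the other comes from a congruence of their cofactors modulo 1 - qⁿ. The
-- truncation is essential: as 2k ≤ n, none of the exponents cn - j with 0 < j < 2k is a multiple of
-- n, and the cleared denominators stay coprime to Φₙ. The facts about Φₙ are not immediate, since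
-- `cyclo` is the output of a fuelled long division of coefficient lists whose exactness has to be
-- proved. That is done by strong induction, jointly with monicity. Over ℤ a Bézout combination of
-- coprime factors reaches only a non-zero constant, so the product of the earlier Φ_d is first seen
-- to divide a constant multiple of qⁿ - 1; monicity then removes the constant.

tri : ℕ → ℕ
tri zero    = 0
tri (suc k) = tri k ℕ.+ k

-- Splits the power q^(k²) of the trinomial summand: q^(k(k+1)/2) is spent on reflecting k factors,
-- and q^(k(k-1)/2) is left for the summand of θₙ.
tri+tri≡k*k : ∀ k → tri (suc k) ℕ.+ tri k ≡ k ℕ.* k
tri+tri≡k*k zero    = ≡.refl
tri+tri≡k*k (suc k) = begin
  t ℕ.+ k ℕ.+ suc k ℕ.+ (t ℕ.+ k)
    ≡⟨ solve 2 (λ t k → t :+ k :+ (con 1 :+ k) :+ (t :+ k) := (t :+ k :+ t) :+ (con 1 :+ k :+ k)) ≡.refl t k ⟩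
  (t ℕ.+ k ℕ.+ t) ℕ.+ (suc k ℕ.+ k)
    ≡⟨ cong (ℕ._+ (suc k ℕ.+ k)) (tri+tri≡k*k k) ⟩
  k ℕ.* k ℕ.+ (suc k ℕ.+ k)
    ≡⟨ solve 1 (λ k → k :* k :+ (con 1 :+ k :+ k) := (con 1 :+ k) :* (con 1 :+ k)) ≡.refl k ⟩
  suc k ℕ.* suc k ∎
  where
  open ≡.≡-Reasoning
  open +-*-Solver
  t = tri k

-- The pentagonal numbers m(3m-1)/2 as sums 1 + 4 + 7 + ..., the increments being the exponents that
-- `A-rec` contributes. The companions m(3m+1)/2 appear as `m + pent m`.
pent : ℕ → ℕ
pent zero    = 0
pent (suc m) = suc (m ℕ.* 3) ℕ.+ pent m

2+3m+[m+pent] : ∀ m → 2 ℕ.+ m ℕ.* 3 ℕ.+ (m ℕ.+ pent m) ≡ suc m ℕ.+ pent (suc m)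
2+3m+[m+pent] m = solve 2 (λ m p →
    con 2 :+ m :* con 3 :+ (m :+ p) := con 1 :+ m :+ (con 1 :+ m :* con 3 :+ p)) ≡.refl m (pent m)
  where open +-*-Solver

tri-exponent : ∀ t k r → t ℕ.+ k ℕ.+ suc k ℕ.+ r ≡ suc (k ℕ.+ (k ℕ.+ r)) ℕ.+ t
tri-exponent = solve 3 (λ t k r →
    t :+ k :+ (con 1 :+ k) :+ r := con 1 :+ (k :+ (k :+ r)) :+ t) ≡.refl
  where open +-*-Solver

k*2≡k+k : ∀ k → k ℕ.* 2 ≡ k ℕ.+ k
k*2≡k+k k = ≡.trans (ℕₚ.*-comm k 2) (cong (k ℕ.+_) (ℕₚ.+-identityʳ k))

m∸[o+o]≡n+m∸o∸[n+o] : ∀ n m o → m ∸ (o ℕ.+ o) ≡ n ℕ.+ m ∸ o ∸ (n ℕ.+ o)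
m∸[o+o]≡n+m∸o∸[n+o] n m o = begin
  m ∸ (o ℕ.+ o)                ≡⟨ ℕₚ.[m+n]∸[m+o]≡n∸o n m (o ℕ.+ o) ⟨
  n ℕ.+ m ∸ (n ℕ.+ (o ℕ.+ o))  ≡⟨ cong (n ℕ.+ m ∸_) (≡.trans (≡.sym (ℕₚ.+-assoc n o o)) (ℕₚ.+-comm (n ℕ.+ o) o)) ⟩
  n ℕ.+ m ∸ (o ℕ.+ (n ℕ.+ o))  ≡⟨ ℕₚ.∸-+-assoc (n ℕ.+ m) o (n ℕ.+ o) ⟨
  n ℕ.+ m ∸ o ∸ (n ℕ.+ o)      ∎
  where open ≡.≡-Reasoning

-- What the q-series need of ℤ[q]: integer constants for the ring solver, powers of q, and
-- regularity of 1 - qʲ in place of division.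
record QRing {ℓ₁ ℓ₂} (R : CommutativeRing ℓ₁ ℓ₂) : Set (ℓ₁ ⊔ ℓ₂) where
  open CommutativeRing R
  field
    hom : CommutativeRing.rawRing ℤₚ.+-*-commutativeRing
            -Raw-AlmostCommutative⟶ fromCommutativeRing R
  open _-Raw-AlmostCommutative⟶_ hom public renaming (⟦_⟧ to ι)
  field
    q^_          : ℕ → Carrier
    q^0≈1        : q^ 0 ≈ ι 1ℤ
    q^-+         : ∀ m n → q^ (m ℕ.+ n) ≈ q^ m * q^ n
    1-q^-regular : ∀ j x → (ι 1ℤ - q^ suc j) * x ≈ 0# → x ≈ 0#

module QSeries {ℓ₁ ℓ₂} (R : CommutativeRing ℓ₁ ℓ₂) (qRing : QRing R) where

  open CommutativeRing R
  open QRing qRing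
  open SetoidReasoning setoid
  open RingSolver (CommutativeRing.rawRing ℤₚ.+-*-commutativeRing) (fromCommutativeRing R) hom
    (λ a b → Maybe.map (reflexive ∘ cong ι) (dec⇒maybe (a ℤₚ.≟ b)))
    using (solve; _:=_; _:+_; _:*_; _:-_; :-_; con)

  -- The unit is written as an image of `ι`, so that it is literally what the solver's `con 1ℤ`
  -- evaluates to.
  𝟙 : Carrier
  𝟙 = ι 1ℤ

  infix 9 1-q^_
  1-q^_ : ℕ → Carrier
  1-q^ j = 𝟙 - q^ j

  1-q^0≈0 : 1-q^ 0 ≈ 0#
  1-q^0≈0 = trans (+-congˡ (-‿cong q^0≈1)) (-‿inverseʳ 𝟙)

  -- The Euclidean step on exponents; it transfers Bézout identities from integers to the
  -- polynomials 1 - qʲ.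
  1-q^-+ : ∀ d e → 1-q^ (d ℕ.+ e) - q^ d * 1-q^ e ≈ 1-q^ d
  1-q^-+ d e = trans (+-congʳ (+-congˡ (-‿cong (q^-+ d e))))
    (solve 2 (λ x y → con 1ℤ :- x :* y :- x :* (con 1ℤ :- y) := con 1ℤ :- x) refl (q^ d) (q^ e))

  -- q-factorials and Gaussian polynomials

  fac : ℕ → Carrier
  fac zero    = 𝟙
  fac (suc m) = fac m * 1-q^ suc m

  fall : ℕ → ℕ → Carrier
  fall n zero    = 𝟙
  fall n (suc m) = fall n m * 1-q^ (n ∸ m)

  rise : ℕ → ℕ → Carrier
  rise x zero    = 𝟙
  rise x (suc m) = rise x m * 1-q^ (x ℕ.+ suc m)

  gauss : ℕ → ℕ → Carrier
  gauss n       zero    = 𝟙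
  gauss zero    (suc m) = 0#
  gauss (suc n) (suc m) = gauss n m + q^ suc m * gauss n (suc m)

  gauss-> : ∀ {n m} → n < m → gauss n m ≈ 0#
  gauss-> {zero}  {suc m} n<m       = refl
  gauss-> {suc n} {suc m} (s<s n<m) = begin
    gauss n m + q^ suc m * gauss n (suc m)
      ≈⟨ +-cong (gauss-> n<m) (*-congˡ (gauss-> (ℕₚ.m<n⇒m<1+n n<m))) ⟩
    0# + q^ suc m * 0#
      ≈⟨ trans (+-identityˡ _) (zeroʳ _) ⟩
    0# ∎

  fall-suc : ∀ n m → fall (suc n) (suc m) ≈ 1-q^ suc n * fall n m
  fall-suc n zero    = *-comm 𝟙 (1-q^ suc n)
  fall-suc n (suc m) = trans (*-congʳ (fall-suc n m)) (*-assoc _ _ _)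

  -- The factor with index n has exponent n ∸ n = 0, and 1 - q⁰ vanishes.
  fall-> : ∀ {n m} → n < m → fall n m ≈ 0#
  fall-> {n} {suc m} (s≤s n≤m) with ℕₚ.m≤n⇒m<n∨m≡n n≤m
  ... | inj₁ n<m    = trans (*-congʳ (fall-> n<m)) (zeroˡ _)
  ... | inj₂ ≡.refl = begin
    fall n n * 1-q^ (n ∸ n)  ≡⟨ cong (λ j → fall n n * 1-q^ j) (ℕₚ.n∸n≡0 n) ⟩
    fall n n * 1-q^ 0        ≈⟨ *-congˡ 1-q^0≈0 ⟩
    fall n n * 0#            ≈⟨ zeroʳ _ ⟩
    0#                       ∎

  q^-∸ : ∀ {m n} → m ≤ n → q^ n ≈ q^ m * q^ (n ∸ m)
  q^-∸ {m} {n} m≤n = trans (reflexive (cong q^_ (≡.sym (ℕₚ.m+[n∸m]≡n m≤n)))) (q^-+ m (n ∸ m))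

  fall-pascal : ∀ n m →
    fall n m * 1-q^ suc m + q^ suc m * (fall n m * 1-q^ (n ∸ m)) ≈ 1-q^ suc n * fall n m
  fall-pascal n m with m ℕ.≤? n
  ... | yes m≤n = begin
    fall n m * 1-q^ suc m + q^ suc m * (fall n m * 1-q^ (n ∸ m))
      ≈⟨ solve 3 (λ f x y → f :* (con 1ℤ :- x) :+ x :* (f :* (con 1ℤ :- y))
                            := (con 1ℤ :- x :* y) :* f) refl (fall n m) (q^ suc m) (q^ (n ∸ m)) ⟩
    (𝟙 - q^ suc m * q^ (n ∸ m)) * fall n m
      ≈⟨ *-congʳ (+-congˡ (-‿cong (q^-∸ (s≤s m≤n)))) ⟨
    1-q^ suc n * fall n m ∎
  ... | no m≰n = begin
    fall n m * 1-q^ suc m + q^ suc m * (fall n m * 1-q^ (n ∸ m))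
      ≈⟨ solve 4 (λ f x y z → f :* x :+ y :* (f :* z) := (x :+ y :* z) :* f) refl _ _ _ _ ⟩
    (1-q^ suc m + q^ suc m * 1-q^ (n ∸ m)) * fall n m
      ≈⟨ trans (*-congˡ f≈0) (zeroʳ _) ⟩
    0#  ≈⟨ trans (*-congˡ f≈0) (zeroʳ _) ⟨
    1-q^ suc n * fall n m ∎
    where
    f≈0 = fall-> (ℕₚ.≰⇒> m≰n)

  gauss-fac : ∀ n m → gauss n m * fac m ≈ fall n m
  gauss-fac n       zero    = solve 0 (con 1ℤ :* con 1ℤ := con 1ℤ) refl
  gauss-fac zero    (suc m) = trans (zeroˡ _) (sym (fall-> {0} {suc m} z<s))
  gauss-fac (suc n) (suc m) = begin
    (gauss n m + q^ suc m * gauss n (suc m)) * (fac m * 1-q^ suc m)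
      ≈⟨ solve 5 (λ g x h f y → (g :+ x :* h) :* (f :* y) := g :* f :* y :+ x :* (h :* (f :* y)))
           refl _ _ _ _ _ ⟩
    gauss n m * fac m * 1-q^ suc m + q^ suc m * (gauss n (suc m) * fac (suc m))
      ≈⟨ +-cong (*-congʳ (gauss-fac n m)) (*-congˡ (gauss-fac n (suc m))) ⟩
    fall n m * 1-q^ suc m + q^ suc m * (fall n m * 1-q^ (n ∸ m))
      ≈⟨ fall-pascal n m ⟩
    1-q^ suc n * fall n m
      ≈⟨ fall-suc n m ⟨
    fall (suc n) (suc m) ∎

  fall-fac : ∀ {n m} → m ≤ n → fall n m * fac (n ∸ m) ≈ fac n
  fall-fac {n} {zero}  m≤n = solve 1 (λ f → con 1ℤ :* f := f) refl (fac n)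
  fall-fac {n} {suc m} m<n = begin
    fall n m * 1-q^ (n ∸ m) * fac (n ∸ suc m)
      ≈⟨ solve 3 (λ f x g → f :* x :* g := f :* (g :* x)) refl _ _ _ ⟩
    fall n m * (fac (n ∸ suc m) * 1-q^ (n ∸ m))
      ≡⟨ cong (λ j → fall n m * (fac (n ∸ suc m) * 1-q^ j)) n∸m≡ ⟩
    fall n m * fac (suc (n ∸ suc m))
      ≡⟨ cong (λ j → fall n m * fac j) n∸m≡ ⟨
    fall n m * fac (n ∸ m)
      ≈⟨ fall-fac (ℕₚ.<⇒≤ m<n) ⟩
    fac n ∎
    where
    n∸m≡ : n ∸ m ≡ suc (n ∸ suc m)
    n∸m≡ = ℕₚ.+-∸-assoc 1 m<n

  gauss-fac-fac : ∀ {n m} → m ≤ n → gauss n m * fac m * fac (n ∸ m) ≈ fac n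
  gauss-fac-fac {n} {m} m≤n = trans (*-congʳ (gauss-fac n m)) (fall-fac m≤n)

  fac-rise : ∀ x m → fac x * rise x m ≈ fac (x ℕ.+ m)
  fac-rise x zero    = trans (solve 1 (λ f → f :* con 1ℤ := f) refl (fac x))
    (reflexive (cong fac (≡.sym (ℕₚ.+-identityʳ x))))
  fac-rise x (suc m) = begin
    fac x * (rise x m * 1-q^ (x ℕ.+ suc m))    ≈⟨ *-assoc _ _ _ ⟨
    fac x * rise x m * 1-q^ (x ℕ.+ suc m)      ≈⟨ *-congʳ (fac-rise x m) ⟩
    fac (x ℕ.+ m) * 1-q^ (x ℕ.+ suc m)         ≡⟨ cong (λ j → fac (x ℕ.+ m) * 1-q^ j) (ℕₚ.+-suc x m) ⟩
    fac (suc (x ℕ.+ m))                        ≡⟨ cong fac (ℕₚ.+-suc x m) ⟨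
    fac (x ℕ.+ suc m) ∎

  1-q^-cancel : ∀ j {x y} → 1-q^ suc j * x ≈ 1-q^ suc j * y → x ≈ y
  1-q^-cancel j {x} {y} e = begin
    x            ≈⟨ solve 2 (λ x y → x := x :- y :+ y) refl x y ⟩
    x - y + y    ≈⟨ +-congʳ (1-q^-regular j (x - y) (begin
      1-q^ suc j * (x - y)             ≈⟨ solve 3 (λ f x y → f :* (x :- y) := f :* x :- f :* y) refl _ _ _ ⟩
      1-q^ suc j * x - 1-q^ suc j * y  ≈⟨ +-congʳ e ⟩
      1-q^ suc j * y - 1-q^ suc j * y  ≈⟨ -‿inverseʳ _ ⟩
      0#                               ∎)) ⟩
    0# + y       ≈⟨ +-identityˡ y ⟩
    y            ∎

  fac-cancel : ∀ m {x y} → fac m * x ≈ fac m * y → x ≈ y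
  fac-cancel zero    {x} {y} e = trans (𝟙* x) (trans e (sym (𝟙* y)))
    where
    𝟙* : ∀ x → x ≈ 𝟙 * x
    𝟙* = solve 1 (λ x → x := con 1ℤ :* x) refl
  fac-cancel (suc m) e = 1-q^-cancel m
    (fac-cancel m (trans (sym (*-assoc _ _ _)) (trans e (*-assoc _ _ _))))

  -- The mirror image of the rule that defines `gauss`. With x = q^(m+1) and y = q^(n-m), the
  -- product formula reduces it to 1 - xy = y(1 - x) + (1 - y).
  gauss-pascal′ : ∀ {n m} → m ≤ n →
    gauss (suc n) (suc m) ≈ q^ (n ∸ m) * gauss n m + gauss n (suc m)
  gauss-pascal′ {n} {m} m≤n = fac-cancel (suc m) (begin
    fac (suc m) * gauss (suc n) (suc m)
      ≈⟨ trans (*-comm _ _) (gauss-fac (suc n) (suc m)) ⟩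
    fall (suc n) (suc m)
      ≈⟨ fall-suc n m ⟩
    1-q^ suc n * fall n m
      ≈⟨ *-congʳ (+-congˡ (-‿cong (q^-∸ (s≤s m≤n)))) ⟩
    (𝟙 - q^ suc m * q^ (n ∸ m)) * fall n m
      ≈⟨ solve 3 (λ f x y → (con 1ℤ :- x :* y) :* f
                    := y :* f :* (con 1ℤ :- x) :+ f :* (con 1ℤ :- y)) refl _ _ _ ⟩
    q^ (n ∸ m) * fall n m * 1-q^ suc m + fall n m * 1-q^ (n ∸ m)
      ≈⟨ +-cong (*-congʳ (*-congˡ (gauss-fac n m))) (gauss-fac n (suc m)) ⟨
    q^ (n ∸ m) * (gauss n m * fac m) * 1-q^ suc m + gauss n (suc m) * fac (suc m)
      ≈⟨ solve 5 (λ y g f x h → y :* (g :* f) :* x :+ h :* (f :* x)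
                    := f :* x :* (y :* g :+ h)) refl _ _ _ _ _ ⟩
    fac (suc m) * (q^ (n ∸ m) * gauss n m + gauss n (suc m)) ∎)

  fall-split : ∀ n a b → fall n (a ℕ.+ b) ≈ fall n a * fall (n ∸ a) b
  fall-split n a zero = trans (reflexive (cong (fall n) (ℕₚ.+-identityʳ a)))
    (solve 1 (λ f → f := f :* con 1ℤ) refl _)
  fall-split n a (suc b) = begin
    fall n (a ℕ.+ suc b)
      ≡⟨ cong (fall n) (ℕₚ.+-suc a b) ⟩
    fall n (a ℕ.+ b) * 1-q^ (n ∸ (a ℕ.+ b))
      ≈⟨ *-cong (fall-split n a b) (reflexive (cong 1-q^_ (≡.sym (ℕₚ.∸-+-assoc n a b)))) ⟩
    fall n a * fall (n ∸ a) b * 1-q^ (n ∸ a ∸ b)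
      ≈⟨ *-assoc _ _ _ ⟩
    fall n a * fall (n ∸ a) (suc b) ∎

  -- A finite pentagonal number theorem

  sumTo : ℕ → (ℕ → Carrier) → Carrier
  sumTo zero    f = f 0
  sumTo (suc N) f = sumTo N f + f (suc N)

  sumTo-shift : ∀ N c {f g h} → f 0 ≈ g 0 →
    (∀ {k} → k ≤ N → f (suc k) ≈ g (suc k) - c * h k) →
    sumTo (suc N) f ≈ sumTo (suc N) g - c * sumTo N h
  sumTo-shift zero c {f} {g} {h} e₀ e = begin
    f 0 + f 1                ≈⟨ +-cong e₀ (e z≤n) ⟩
    g 0 + (g 1 - c * h 0)    ≈⟨ +-assoc _ _ _ ⟨
    g 0 + g 1 - c * h 0      ∎
  sumTo-shift (suc N) c {f} {g} {h} e₀ e = begin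
    sumTo (suc N) f + f (2 ℕ.+ N)
      ≈⟨ +-cong (sumTo-shift N c e₀ (e ∘ ℕₚ.m≤n⇒m≤1+n)) (e ℕₚ.≤-refl) ⟩
    sumTo (suc N) g - c * sumTo N h + (g (2 ℕ.+ N) - c * h (suc N))
      ≈⟨ solve 5 (λ a c b x y → a :- c :* b :+ (x :- c :* y) := a :+ x :- c :* (b :+ y))
           refl _ _ _ _ _ ⟩
    sumTo (2 ℕ.+ N) g - c * sumTo (suc N) h ∎

  sumTo-tail : ∀ j N {f} → (∀ {k} → N < k → f k ≈ 0#) → sumTo (j ℕ.+ N) f ≈ sumTo N f
  sumTo-tail zero    N e = refl
  sumTo-tail (suc j) N e =
    trans (+-cong (sumTo-tail j N e) (e (s≤s (ℕₚ.m≤n+m N j)))) (+-identityʳ _)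

  sgn : ℕ → Carrier
  sgn k = ι (-1ℤ ℤ.^ k)

  sgn-suc : ∀ k → sgn (suc k) ≈ - sgn k
  sgn-suc k = trans (*-homo -1ℤ _) (solve 1 (λ s → con -1ℤ :* s := :- s) refl (sgn k))

  -- ∑ₖ α n k and ∑ₖ β n k are the values at x = 1 and x = q of
  -- ∑ₖ (-x)ᵏ q^(k(k-1)/2) [n-k, k]; the two q-Pascal rules give a coupled
  -- recurrence for them.
  α β : ℕ → ℕ → Carrier
  α n k = sgn k * q^ tri k * gauss (n ∸ k) k
  β n k = sgn k * q^ tri (suc k) * gauss (n ∸ k) k

  n<2k⇒n∸k<k : ∀ n k → n < k ℕ.+ k → n ∸ k < k
  n<2k⇒n∸k<k n zero    ()
  n<2k⇒n∸k<k n (suc k) lt = ℕₚ.m<n+o⇒m∸n<o n (suc k) lt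

  α-vanish : ∀ n k → n < k ℕ.+ k → α n k ≈ 0#
  α-vanish n k lt = trans (*-congˡ (gauss-> (n<2k⇒n∸k<k n k lt))) (zeroʳ _)

  -- In the defining Pascal rule the extra power q^(k+1) raises `tri (suc k)` to `tri (2 + k)`,
  -- which turns the weight of `α` into that of `β`.
  α-rec : ∀ {n k} → k ≤ n → α (2 ℕ.+ n) (suc k) ≈ β (1 ℕ.+ n) (suc k) - 𝟙 * β n k
  α-rec {n} {k} k≤n = begin
    sgn (suc k) * q^ tri (suc k) * gauss (suc n ∸ k) (suc k)
      ≡⟨ cong (λ j → sgn (suc k) * q^ tri (suc k) * gauss j (suc k)) (ℕₚ.+-∸-assoc 1 k≤n) ⟩
    sgn (suc k) * q^ tri (suc k) * (gauss (n ∸ k) k + q^ suc k * gauss (n ∸ k) (suc k))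
      ≈⟨ solve 5 (λ s t g x h → s :* t :* (g :+ x :* h) := s :* (t :* x) :* h :+ s :* t :* g)
           refl _ _ _ _ _ ⟩
    sgn (suc k) * (q^ tri (suc k) * q^ suc k) * gauss (n ∸ k) (suc k)
      + sgn (suc k) * q^ tri (suc k) * gauss (n ∸ k) k
      ≈⟨ +-cong (*-congʳ (*-congˡ (sym (q^-+ _ (suc k))))) (*-congʳ (*-congʳ (sgn-suc k))) ⟩
    β (suc n) (suc k) + - sgn k * q^ tri (suc k) * gauss (n ∸ k) k
      ≈⟨ solve 4 (λ b s t g → b :+ :- s :* t :* g := b :- con 1ℤ :* (s :* t :* g)) refl _ _ _ _ ⟩
    β (suc n) (suc k) - 𝟙 * β n k ∎

  -- The mirrored Pascal rule brings in q^(n-2k). As `tri (2 + k)` is `tri k` + 2k + 1, this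
  -- combines to q^(n+1) times q^(tri k), and a factor independent of k can leave the sum. If k > n
  -- - k, all three Gaussian polynomials vanish.
  gauss-pascal-top : ∀ {n k} → k ≤ n →
    q^ tri (2 ℕ.+ k) * gauss (suc (n ∸ k)) (suc k)
      ≈ q^ tri (2 ℕ.+ k) * gauss (n ∸ k) (suc k) + q^ suc n * (q^ tri k * gauss (n ∸ k) k)
  gauss-pascal-top {n} {k} k≤n with k ℕ.≤? n ∸ k
  ... | yes k≤n∸k = begin
    T * gauss (suc (n ∸ k)) (suc k)
      ≈⟨ *-congˡ (gauss-pascal′ k≤n∸k) ⟩
    T * (q^ (n ∸ k ∸ k) * gauss (n ∸ k) k + gauss (n ∸ k) (suc k))
      ≈⟨ solve 4 (λ t x g h → t :* (x :* g :+ h) := t :* h :+ (t :* x) :* g) refl _ _ _ _ ⟩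
    T * gauss (n ∸ k) (suc k) + T * q^ (n ∸ k ∸ k) * gauss (n ∸ k) k
      ≈⟨ +-congˡ (*-congʳ (begin
           T * q^ (n ∸ k ∸ k)                       ≈⟨ q^-+ _ (n ∸ k ∸ k) ⟨
           q^ (tri (2 ℕ.+ k) ℕ.+ (n ∸ k ∸ k))       ≡⟨ cong q^_ exponent ⟩
           q^ (suc n ℕ.+ tri k)                     ≈⟨ q^-+ (suc n) (tri k) ⟩
           q^ suc n * q^ tri k                      ∎)) ⟩
    T * gauss (n ∸ k) (suc k) + q^ suc n * q^ tri k * gauss (n ∸ k) k
      ≈⟨ +-congˡ (*-assoc _ _ _) ⟩
    T * gauss (n ∸ k) (suc k) + q^ suc n * (q^ tri k * gauss (n ∸ k) k) ∎
    where
    T = q^ tri (2 ℕ.+ k)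
    exponent : tri k ℕ.+ k ℕ.+ suc k ℕ.+ (n ∸ k ∸ k) ≡ suc n ℕ.+ tri k
    exponent = ≡.trans (tri-exponent (tri k) k (n ∸ k ∸ k))
      (cong (λ z → suc z ℕ.+ tri k)
        (≡.trans (cong (k ℕ.+_) (ℕₚ.m+[n∸m]≡n k≤n∸k)) (ℕₚ.m+[n∸m]≡n k≤n)))
  ... | no k≰n∸k = trans (zero′ (s<s k>)) (sym (trans
    (+-cong (zero′ (ℕₚ.m<n⇒m<1+n k>)) (trans (*-congˡ (zero′ k>)) (zeroʳ _))) (+-identityˡ 0#)))
    where
    k> = ℕₚ.≰⇒> k≰n∸k
    zero′ : ∀ {x i j} → i < j → x * gauss i j ≈ 0#
    zero′ lt = trans (*-congˡ (gauss-> lt)) (zeroʳ _)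

  β-rec : ∀ {n k} → k ≤ n → β (2 ℕ.+ n) (suc k) ≈ β (1 ℕ.+ n) (suc k) - q^ suc n * α n k
  β-rec {n} {k} k≤n = begin
    sgn (suc k) * q^ tri (2 ℕ.+ k) * gauss (suc n ∸ k) (suc k)
      ≡⟨ cong (λ j → sgn (suc k) * q^ tri (2 ℕ.+ k) * gauss j (suc k)) (ℕₚ.+-∸-assoc 1 k≤n) ⟩
    sgn (suc k) * q^ tri (2 ℕ.+ k) * gauss (suc (n ∸ k)) (suc k)
      ≈⟨ trans (*-assoc _ _ _) (*-congˡ (gauss-pascal-top k≤n)) ⟩
    sgn (suc k) * (q^ tri (2 ℕ.+ k) * gauss (n ∸ k) (suc k) + q^ suc n * (q^ tri k * gauss (n ∸ k) k))
      ≈⟨ solve 6 (λ s t h x u g → s :* (t :* h :+ x :* (u :* g)) := s :* t :* h :+ s :* (x :* (u :* g)))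
           refl _ _ _ _ _ _ ⟩
    β (suc n) (suc k) + sgn (suc k) * (q^ suc n * (q^ tri k * gauss (n ∸ k) k))
      ≈⟨ +-congˡ (*-congʳ (sgn-suc k)) ⟩
    β (suc n) (suc k) + - sgn k * (q^ suc n * (q^ tri k * gauss (n ∸ k) k))
      ≈⟨ solve 5 (λ b s x u g → b :+ :- s :* (x :* (u :* g)) := b :- x :* (s :* u :* g))
           refl _ _ _ _ _ ⟩
    β (suc n) (suc k) - q^ suc n * α n k ∎

  A : ℕ → Carrier
  A n = sumTo n (α n)

  -- With bₙ for the sum of `β n`, the two recurrences read A(n+2) = b(n+1) - b(n) and b(n+2) =
  -- b(n+1) - q^(n+1) A(n). Substituting the second into the first at n+1 eliminates b; the summands
  -- at the ends of the ranges vanish because 2k exceeds the first argument.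
  A-rec : ∀ n → A (3 ℕ.+ n) ≈ - q^ suc n * A n
  A-rec n = begin
    A (3 ℕ.+ n)
      ≈⟨ sumTo-tail 2 (suc n) (λ {k} n<k → α-vanish (3 ℕ.+ n) k
           (ℕₚ.≤-trans (ℕₚ.+-monoʳ-≤ 2 (ℕₚ.m≤n+m (2 ℕ.+ n) n)) (ℕₚ.+-mono-≤ n<k n<k))) ⟩
    sumTo (suc n) (α (3 ℕ.+ n))
      ≈⟨ sumTo-shift n 𝟙 refl (λ k≤n → α-rec (ℕₚ.m≤n⇒m≤1+n k≤n)) ⟩
    sumTo (suc n) (β (2 ℕ.+ n)) - 𝟙 * sumTo n (β (suc n))
      ≈⟨ +-congʳ (sumTo-shift n (q^ suc n) refl β-rec) ⟩
    sumTo n (β (suc n)) + β (suc n) (suc n) - q^ suc n * A n - 𝟙 * sumTo n (β (suc n))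
      ≈⟨ solve 4 (λ s b x a → s :+ b :- x :* a :- con 1ℤ :* s := b :+ :- x :* a) refl _ _ _ _ ⟩
    β (suc n) (suc n) + - q^ suc n * A n
      ≈⟨ +-congʳ (trans (*-congˡ (gauss-> (n<2k⇒n∸k<k (suc n) (suc n) (ℕₚ.m<m+n (suc n) z<s)))) (zeroʳ _)) ⟩
    0# + - q^ suc n * A n
      ≈⟨ +-identityˡ _ ⟩
    - q^ suc n * A n ∎

  -- The k-th summand, k ≥ 1, is (-1)ᵏ q^(k(k-1)/2) (1-qⁿ)/(1-qⁿ⁻ᵏ) [n-k, k],
  -- written so that no division occurs.
  lucasCoeff : ℕ → ℕ → Carrier
  lucasCoeff n zero    = 𝟙
  lucasCoeff n (suc k) = gauss (n ∸ suc k) (suc k) + q^ (n ∸ suc k) * gauss (n ∸ suc (suc k)) k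

  lucasTerm : ℕ → ℕ → Carrier
  lucasTerm n k = sgn k * q^ tri k * lucasCoeff n k

  lucas : ℕ → Carrier
  lucas n = sumTo (n ℕ./ 2) (lucasTerm n)

  -- The second half of `lucasCoeff` carries q^(n+1-k), and `tri (suc k)` + (n+1-k) = (n+1) +
  -- `tri k`, so it is a multiple of `α n k` by a factor free of k. Summed up, this is the
  -- q-analogue of writing Lucas polynomials through Fibonacci polynomials.
  lucasTerm-α : ∀ {n k} → k ≤ n →
    lucasTerm (2 ℕ.+ n) (suc k) ≈ α (2 ℕ.+ n) (suc k) - q^ suc n * α n k
  lucasTerm-α {n} {k} k≤n = begin
    sgn (suc k) * q^ tri (suc k) * (gauss (suc n ∸ k) (suc k) + q^ (suc n ∸ k) * gauss (n ∸ k) k)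
      ≈⟨ solve 5 (λ s t g x h → s :* t :* (g :+ x :* h) := s :* t :* g :+ s :* ((t :* x) :* h))
           refl _ _ _ _ _ ⟩
    α (2 ℕ.+ n) (suc k) + sgn (suc k) * (q^ tri (suc k) * q^ (suc n ∸ k) * gauss (n ∸ k) k)
      ≈⟨ +-congˡ (*-cong (sgn-suc k) (*-congʳ (begin
           q^ tri (suc k) * q^ (suc n ∸ k)     ≈⟨ q^-+ (tri (suc k)) (suc n ∸ k) ⟨
           q^ (tri k ℕ.+ k ℕ.+ (suc n ∸ k))    ≡⟨ cong q^_ exponent ⟩
           q^ (suc n ℕ.+ tri k)                ≈⟨ q^-+ (suc n) (tri k) ⟩
           q^ suc n * q^ tri k                 ∎))) ⟩
    α (2 ℕ.+ n) (suc k) + - sgn k * (q^ suc n * q^ tri k * gauss (n ∸ k) k)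
      ≈⟨ solve 5 (λ a s x t g → a :+ :- s :* (x :* t :* g) := a :- x :* (s :* t :* g)) refl _ _ _ _ _ ⟩
    α (2 ℕ.+ n) (suc k) - q^ suc n * α n k ∎
    where
    exponent : tri k ℕ.+ k ℕ.+ (suc n ∸ k) ≡ suc n ℕ.+ tri k
    exponent = ≡.trans (ℕₚ.+-assoc (tri k) k _)
      (≡.trans (cong (tri k ℕ.+_) (ℕₚ.m+[n∸m]≡n (ℕₚ.m≤n⇒m≤1+n k≤n))) (ℕₚ.+-comm (tri k) (suc n)))

  sumTo-half : ∀ n → sumTo (n ℕ./ 2) (α n) ≈ A n
  sumTo-half n = begin
    sumTo h (α n)            ≈⟨ sumTo-tail (n ∸ h) h (λ {k} h<k → α-vanish n k (n<2k h<k)) ⟨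
    sumTo (n ∸ h ℕ.+ h) (α n) ≡⟨ cong (λ N → sumTo N (α n)) (ℕₚ.m∸n+n≡m (ℕ/.m/n≤m n 2)) ⟩
    A n                      ∎
    where
    h = n ℕ./ 2
    n<2k : ∀ {k} → h < k → n < k ℕ.+ k
    n<2k {k} h<k = ℕₚ.≰⇒> λ 2k≤n → ℕₚ.<⇒≱ h<k (ℕₚ.≤-trans
      (ℕₚ.≤-reflexive (≡.sym (ℕ/.m*n/n≡m k 2)))
      (ℕ/./-monoˡ-≤ 2 (≡.subst (_≤ n) (≡.sym (k*2≡k+k k)) 2k≤n)))

  lucas-A : ∀ n → lucas (2 ℕ.+ n) ≈ A (2 ℕ.+ n) - q^ suc n * A n
  lucas-A n = begin
    sumTo ((2 ℕ.+ n) ℕ./ 2) (lucasTerm (2 ℕ.+ n))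
      ≡⟨ cong (λ N → sumTo N (lucasTerm (2 ℕ.+ n))) (half-suc n) ⟩
    sumTo (suc (n ℕ./ 2)) (lucasTerm (2 ℕ.+ n))
      ≈⟨ sumTo-shift (n ℕ./ 2) (q^ suc n) {h = α n} (*-congˡ refl)
           (λ k≤h → lucasTerm-α (ℕₚ.≤-trans k≤h (ℕ/.m/n≤m n 2))) ⟩
    sumTo (suc (n ℕ./ 2)) (α (2 ℕ.+ n)) - q^ suc n * sumTo (n ℕ./ 2) (α n)
      ≈⟨ +-cong (trans (reflexive (cong (λ N → sumTo N (α (2 ℕ.+ n))) (≡.sym (half-suc n))))
                       (sumTo-half (2 ℕ.+ n)))
                (-‿cong (*-congˡ (sumTo-half n))) ⟩
    A (2 ℕ.+ n) - q^ suc n * A n ∎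
    where
    half-suc : ∀ n → (2 ℕ.+ n) ℕ./ 2 ≡ suc (n ℕ./ 2)
    half-suc n = ≡.trans (ℕ/.+-distrib-/-∣ˡ n (∣-refl {2})) ≡.refl

  -- `A-rec` moves in steps of three, so the initial values 1, 1, 0 settle one residue class each.
  -- The zero is the reason why θₙ has two terms only for n = 3m.
  A₀ : A 0 ≈ 𝟙
  A₀ = trans (*-congʳ (*-congˡ q^0≈1)) (solve 0 (con 1ℤ :* con 1ℤ :* con 1ℤ := con 1ℤ) refl)

  A₁ : A 1 ≈ 𝟙
  A₁ = trans (sumTo-tail 1 0 (λ {k} 0<k → α-vanish 1 k (ℕₚ.+-mono-≤ 0<k 0<k))) A₀

  A₂ : A 2 ≈ 0#
  A₂ = begin
    A 2
      ≈⟨ sumTo-tail 1 1 (λ {k} 1<k → α-vanish 2 k (ℕₚ.≤-trans (s≤s (s≤s (s≤s z≤n))) (ℕₚ.+-mono-≤ 1<k 1<k))) ⟩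
    𝟙 * q^ 0 * 𝟙 + sgn 1 * q^ 0 * (𝟙 + q^ 1 * 0#)
      ≈⟨ +-congˡ (*-congˡ (trans (+-congˡ (zeroʳ _)) (+-identityʳ 𝟙))) ⟩
    𝟙 * q^ 0 * 𝟙 + sgn 1 * q^ 0 * 𝟙
      ≈⟨ solve 1 (λ x → con 1ℤ :* x :* con 1ℤ :+ con -1ℤ :* x :* con 1ℤ := con 0ℤ) refl (q^ 0) ⟩
    ι 0ℤ
      ≈⟨ 0-homo ⟩
    0# ∎

  neg-step : ∀ a m e → - q^ a * (sgn m * q^ e) ≈ sgn (suc m) * q^ (a ℕ.+ e)
  neg-step a m e = begin
    - q^ a * (sgn m * q^ e)     ≈⟨ solve 3 (λ a s e → :- a :* (s :* e) := :- s :* (a :* e)) refl _ _ _ ⟩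
    - sgn m * (q^ a * q^ e)     ≈⟨ *-cong (sgn-suc m) (q^-+ a e) ⟨
    sgn (suc m) * q^ (a ℕ.+ e)  ∎

  A-3m : ∀ m → A (m ℕ.* 3) ≈ sgn m * q^ pent m
  A-3m zero    = trans A₀ (trans (solve 0 (con 1ℤ := con 1ℤ :* con 1ℤ) refl) (*-congˡ (sym q^0≈1)))
  A-3m (suc m) = begin
    A (3 ℕ.+ m ℕ.* 3)                           ≈⟨ A-rec (m ℕ.* 3) ⟩
    - q^ suc (m ℕ.* 3) * A (m ℕ.* 3)            ≈⟨ *-congˡ (A-3m m) ⟩
    - q^ suc (m ℕ.* 3) * (sgn m * q^ pent m)    ≈⟨ neg-step (suc (m ℕ.* 3)) m (pent m) ⟩
    sgn (suc m) * q^ pent (suc m)               ∎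

  A-3m+1 : ∀ m → A (1 ℕ.+ m ℕ.* 3) ≈ sgn m * q^ (m ℕ.+ pent m)
  A-3m+1 zero    = trans A₁ (trans (solve 0 (con 1ℤ := con 1ℤ :* con 1ℤ) refl) (*-congˡ (sym q^0≈1)))
  A-3m+1 (suc m) = begin
    A (4 ℕ.+ m ℕ.* 3)                                      ≈⟨ A-rec (1 ℕ.+ m ℕ.* 3) ⟩
    - q^ (2 ℕ.+ m ℕ.* 3) * A (1 ℕ.+ m ℕ.* 3)               ≈⟨ *-congˡ (A-3m+1 m) ⟩
    - q^ (2 ℕ.+ m ℕ.* 3) * (sgn m * q^ (m ℕ.+ pent m))     ≈⟨ neg-step (2 ℕ.+ m ℕ.* 3) m (m ℕ.+ pent m) ⟩
    sgn (suc m) * q^ (2 ℕ.+ m ℕ.* 3 ℕ.+ (m ℕ.+ pent m))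
      ≡⟨ cong (λ e → sgn (suc m) * q^ e) (2+3m+[m+pent] m) ⟩
    sgn (suc m) * q^ (suc m ℕ.+ pent (suc m))              ∎

  A-3m+2 : ∀ m → A (2 ℕ.+ m ℕ.* 3) ≈ 0#
  A-3m+2 zero    = A₂
  A-3m+2 (suc m) = trans (A-rec (2 ℕ.+ m ℕ.* 3)) (trans (*-congˡ (A-3m+2 m)) (zeroʳ _))

  -- Only for this residue class do both `A` values in `lucas-A` survive. At m = 0 the right side
  -- would be 2, whereas `lucas 0` is 1.
  lucas-3m : ∀ m → 0 < m → lucas (m ℕ.* 3) ≈ sgn m * ((𝟙 + q^ m) * q^ pent m)
  lucas-3m (suc m) _ = begin
    lucas (3 ℕ.+ m ℕ.* 3)
      ≈⟨ lucas-A (1 ℕ.+ m ℕ.* 3) ⟩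
    A (3 ℕ.+ m ℕ.* 3) - q^ (2 ℕ.+ m ℕ.* 3) * A (1 ℕ.+ m ℕ.* 3)
      ≈⟨ +-cong (A-3m (suc m)) (-‿cong (*-congˡ (A-3m+1 m))) ⟩
    sgn (suc m) * q^ pent (suc m) - q^ (2 ℕ.+ m ℕ.* 3) * (sgn m * q^ (m ℕ.+ pent m))
      ≈⟨ +-congˡ (trans (solve 2 (λ x y → :- (x :* y) := :- x :* y) refl _ _)
                        (neg-step (2 ℕ.+ m ℕ.* 3) m (m ℕ.+ pent m))) ⟩
    sgn (suc m) * q^ pent (suc m) + sgn (suc m) * q^ (2 ℕ.+ m ℕ.* 3 ℕ.+ (m ℕ.+ pent m))
      ≡⟨ cong (λ e → sgn (suc m) * q^ pent (suc m) + sgn (suc m) * q^ e) (2+3m+[m+pent] m) ⟩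
    sgn (suc m) * q^ pent (suc m) + sgn (suc m) * q^ (suc m ℕ.+ pent (suc m))
      ≈⟨ +-congˡ (*-congˡ (q^-+ (suc m) (pent (suc m)))) ⟩
    sgn (suc m) * q^ pent (suc m) + sgn (suc m) * (q^ suc m * q^ pent (suc m))
      ≈⟨ solve 3 (λ s p x → s :* p :+ s :* (x :* p) := s :* ((con 1ℤ :+ x) :* p)) refl _ _ _ ⟩
    sgn (suc m) * ((𝟙 + q^ suc m) * q^ pent (suc m)) ∎

  lucas-3m+1 : ∀ m → lucas (1 ℕ.+ m ℕ.* 3) ≈ sgn m * q^ (m ℕ.+ pent m)
  lucas-3m+1 zero    = solve 1 (λ x → con 1ℤ :* x :* con 1ℤ := con 1ℤ :* x) refl (q^ 0)
  lucas-3m+1 (suc m) = begin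
    lucas (4 ℕ.+ m ℕ.* 3)
      ≈⟨ lucas-A (2 ℕ.+ m ℕ.* 3) ⟩
    A (4 ℕ.+ m ℕ.* 3) - q^ (3 ℕ.+ m ℕ.* 3) * A (2 ℕ.+ m ℕ.* 3)
      ≈⟨ +-cong (A-3m+1 (suc m)) (-‿cong (trans (*-congˡ (A-3m+2 m)) (zeroʳ _))) ⟩
    sgn (suc m) * q^ (suc m ℕ.+ pent (suc m)) - 0#
      ≈⟨ trans (+-congˡ (-‿cong (sym 0-homo))) (solve 1 (λ x → x :- con 0ℤ := x) refl _) ⟩
    sgn (suc m) * q^ (suc m ℕ.+ pent (suc m)) ∎

  lucas-3m+2 : ∀ m → lucas (2 ℕ.+ m ℕ.* 3) ≈ sgn (suc m) * q^ pent (suc m)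
  lucas-3m+2 m = begin
    lucas (2 ℕ.+ m ℕ.* 3)
      ≈⟨ lucas-A (m ℕ.* 3) ⟩
    A (2 ℕ.+ m ℕ.* 3) - q^ suc (m ℕ.* 3) * A (m ℕ.* 3)
      ≈⟨ +-cong (A-3m+2 m) (-‿cong (*-congˡ (A-3m m))) ⟩
    0# - q^ suc (m ℕ.* 3) * (sgn m * q^ pent m)
      ≈⟨ trans (+-identityˡ _) (solve 2 (λ x y → :- (x :* y) := :- x :* y) refl _ _) ⟩
    - q^ suc (m ℕ.* 3) * (sgn m * q^ pent m)
      ≈⟨ neg-step (suc (m ℕ.* 3)) m (pent m) ⟩
    sgn (suc m) * q^ pent (suc m) ∎

  -- Congruences modulo 1 - qⁿ

  module Modulo (d : Carrier) where

    infix 4 _∼_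
    -- The quotient is kept as data: it becomes part of the explicit cofactor of (1 - qⁿ)².
    record _∼_ (x y : Carrier) : Set (ℓ₁ ⊔ ℓ₂) where
      constructor _,_
      field
        quotient : Carrier
        equality : x ≈ y + d * quotient

    ≈⇒∼ : ∀ {x y} → x ≈ y → x ∼ y
    ≈⇒∼ {x} {y} e = ι 0ℤ , trans e (solve 2 (λ y d → y := y :+ d :* con 0ℤ) refl y d)

    ∼-trans : ∀ {x y z} → x ∼ y → y ∼ z → x ∼ z
    ∼-trans {x} {y} {z} (u , e) (v , f) = v + u , (begin
      x                  ≈⟨ e ⟩
      y + d * u          ≈⟨ +-congʳ f ⟩
      z + d * v + d * u  ≈⟨ solve 4 (λ z d u v → z :+ d :* v :+ d :* u := z :+ d :* (v :+ u)) refl z d u v ⟩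
      z + d * (v + u)    ∎)

    ∼-sym : ∀ {x y} → x ∼ y → y ∼ x
    ∼-sym {x} {y} (u , e) = - u , (begin
      y                    ≈⟨ solve 3 (λ y d u → y := y :+ d :* u :+ d :* :- u) refl y d u ⟩
      y + d * u + d * - u  ≈⟨ +-congʳ e ⟨
      x + d * - u          ∎)

    ∼-+ : ∀ {x x′ y y′} → x ∼ x′ → y ∼ y′ → x + y ∼ x′ + y′
    ∼-+ (u , e) (v , f) = u + v , trans (+-cong e f)
      (solve 5 (λ x y d u v → x :+ d :* u :+ (y :+ d :* v) := x :+ y :+ d :* (u :+ v)) refl _ _ _ _ _)

    ∼-* : ∀ {x x′ y y′} → x ∼ x′ → y ∼ y′ → x * y ∼ x′ * y′
    ∼-* {x′ = x} {y′ = y} (u , e) (v , f) = x * v + u * y + d * (u * v) , trans (*-cong e f)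
      (solve 5 (λ x y d u v → (x :+ d :* u) :* (y :+ d :* v)
                   := x :* y :+ d :* (x :* v :+ u :* y :+ d :* (u :* v))) refl x y d u v)

    ∼-neg : ∀ {x x′} → x ∼ x′ → - x ∼ - x′
    ∼-neg (u , e) = - u , trans (-‿cong e)
      (solve 3 (λ x d u → :- (x :+ d :* u) := :- x :+ d :* :- u) refl _ _ _)

  module _ (n′ : ℕ) where

    private
      n = suc n′

    open Modulo (1-q^ n)

    ∼-refl : ∀ {x} → x ∼ x
    ∼-refl = ≈⇒∼ refl

    q^n∼1 : q^ n ∼ 𝟙
    q^n∼1 = ι -1ℤ , solve 1 (λ x → x := con 1ℤ :+ (con 1ℤ :- x) :* con -1ℤ) refl (q^ n)

    q^cn∼1 : ∀ c → q^ (c ℕ.* n) ∼ 𝟙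
    q^cn∼1 zero    = ≈⇒∼ q^0≈1
    q^cn∼1 (suc c) = ∼-trans (≈⇒∼ (q^-+ n (c ℕ.* n)))
      (∼-trans (∼-* q^n∼1 (q^cn∼1 c)) (≈⇒∼ (solve 0 (con 1ℤ :* con 1ℤ := con 1ℤ) refl)))

    1-q^cn+i∼ : ∀ c i → 1-q^ (c ℕ.* n ℕ.+ i) ∼ 1-q^ i
    1-q^cn+i∼ c i = ∼-+ ∼-refl (∼-neg (∼-trans (≈⇒∼ (q^-+ (c ℕ.* n) i))
      (∼-trans (∼-* (q^cn∼1 c) ∼-refl) (≈⇒∼ (solve 1 (λ x → con 1ℤ :* x := x) refl (q^ i))))))

    -- The quotient of 1 - q^(cn) by 1 - qⁿ, that is 1 + qⁿ + ... + q^((c-1)n), in Horner form.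
    geom : ℕ → Carrier
    geom zero    = ι 0ℤ
    geom (suc c) = 𝟙 + q^ n * geom c

    1-q^cn : ∀ c → 1-q^ (c ℕ.* n) ≈ 1-q^ n * geom c
    1-q^cn zero    = trans 1-q^0≈0 (trans (sym 0-homo)
      (solve 1 (λ x → con 0ℤ := x :* con 0ℤ) refl _))
    1-q^cn (suc c) = begin
      𝟙 - q^ (n ℕ.+ c ℕ.* n)
        ≈⟨ +-congˡ (-‿cong (q^-+ n (c ℕ.* n))) ⟩
      𝟙 - q^ n * q^ (c ℕ.* n)
        ≈⟨ solve 2 (λ x y → con 1ℤ :- x :* y := (con 1ℤ :- x) :+ x :* (con 1ℤ :- y)) refl _ _ ⟩
      1-q^ n + q^ n * 1-q^ (c ℕ.* n)
        ≈⟨ +-congˡ (*-congˡ (1-q^cn c)) ⟩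
      1-q^ n + q^ n * (1-q^ n * geom c)
        ≈⟨ solve 3 (λ d x g → d :+ x :* (d :* g) := d :* (con 1ℤ :+ x :* g)) refl _ _ _ ⟩
      1-q^ n * geom (suc c) ∎

    -- All c powers of qⁿ become 1. This is where the factor a - b comes from, and also the non-zero
    -- constant that makes 1 - qʲ coprime to Φₙ.
    geom∼c : ∀ c → geom c ∼ ι (+ c)
    geom∼c zero    = ∼-refl
    geom∼c (suc c) = ∼-trans (∼-+ (∼-refl {𝟙}) (∼-* q^n∼1 (geom∼c c)))
      (≈⇒∼ (trans (solve 1 (λ x → con 1ℤ :+ con 1ℤ :* x := con 1ℤ :+ x) refl _) (sym (+-homo 1ℤ (+ c)))))

    fall-mod : ∀ c m → m ≤ n → fall (c ℕ.* n ℕ.+ n′) m ∼ fall n′ m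
    fall-mod c zero    m≤n       = ∼-refl
    fall-mod c (suc m) (s≤s m≤n′) = ∼-* (fall-mod c m (ℕₚ.m≤n⇒m≤1+n m≤n′))
      (∼-trans (≈⇒∼ (reflexive (cong 1-q^_ (ℕₚ.+-∸-assoc (c ℕ.* n) m≤n′)))) (1-q^cn+i∼ c (n′ ∸ m)))

    rise-mod : ∀ b m → rise (b ℕ.* n) m ∼ fac m
    rise-mod b zero    = ∼-refl
    rise-mod b (suc m) = ∼-* (rise-mod b m) (1-q^cn+i∼ b (suc m))

    -- Each factor is reflected by qʲ(1 - qⁿ⁻ʲ) = qʲ - qⁿ ≡ -(1 - qʲ); the powers used for j = 1,
    -- ..., m multiply to q^(m(m+1)/2).
    fall-reflect : ∀ m → m ≤ n → q^ tri (suc m) * fall n′ m ∼ sgn m * fac m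
    fall-reflect zero    _          = ≈⇒∼ (*-congʳ q^0≈1)
    fall-reflect (suc m) (s≤s m≤n′) =
      ∼-trans (≈⇒∼ (begin
        q^ tri (2 ℕ.+ m) * (fall n′ m * 1-q^ (n′ ∸ m))
          ≈⟨ *-congʳ (q^-+ (tri (suc m)) (suc m)) ⟩
        q^ tri (suc m) * q^ suc m * (fall n′ m * 1-q^ (n′ ∸ m))
          ≈⟨ solve 4 (λ t x f y → t :* x :* (f :* (con 1ℤ :- y)) := t :* f :* (x :- x :* y)) refl _ _ _ _ ⟩
        q^ tri (suc m) * fall n′ m * (q^ suc m - q^ suc m * q^ (n′ ∸ m))
          ≈⟨ *-congˡ (+-congˡ (-‿cong (q^-∸ (s≤s m≤n′)))) ⟨
        q^ tri (suc m) * fall n′ m * (q^ suc m - q^ n) ∎))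
      (∼-trans (∼-* (fall-reflect m (ℕₚ.m≤n⇒m≤1+n m≤n′)) (∼-+ ∼-refl (∼-neg q^n∼1)))
      (≈⇒∼ (begin
        sgn m * fac m * (q^ suc m - 𝟙)
          ≈⟨ solve 3 (λ s f x → s :* f :* (x :- con 1ℤ) := :- s :* (f :* (con 1ℤ :- x))) refl _ _ _ ⟩
        - sgn m * fac (suc m)
          ≈⟨ *-congʳ (sgn-suc m) ⟨
        sgn (suc m) * fac (suc m) ∎)))

  trinomial-fac : ∀ X Y k → k ℕ.+ k ≤ Y →
    gauss (X ℕ.+ Y) k * gauss (X ℕ.+ Y ∸ k) (X ℕ.+ k) * (fac k * rise X k)
      ≈ gauss (X ℕ.+ Y) X * fall Y (k ℕ.+ k)
  -- After multiplication by `fac X` and `fac (Y ∸ (k + k))` both sides equal `fac (X + Y)`: the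
  -- left one since the trinomial has denominators `fac k`, `fac (X + k)` and `fac (Y ∸ (k + k))`,
  -- and `fac (X + k)` is `fac X * rise X k`.
  trinomial-fac X Y k 2k≤Y = fac-cancel X (fac-cancel (Y ∸ (k ℕ.+ k)) (begin
    fac r * (fac X * (g₁ * g₂ * (fac k * rise X k)))
      ≈⟨ solve 6 (λ r x g h f i → r :* (x :* (g :* h :* (f :* i))) := g :* f :* (h :* (x :* i) :* r))
           refl _ _ _ _ _ _ ⟩
    g₁ * fac k * (g₂ * (fac X * rise X k) * fac r)
      ≈⟨ *-congˡ (*-cong (*-congˡ (fac-rise X k)) (reflexive (cong fac (m∸[o+o]≡n+m∸o∸[n+o] X Y k)))) ⟩
    g₁ * fac k * (g₂ * fac (X ℕ.+ k) * fac (N ∸ k ∸ (X ℕ.+ k)))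
      ≈⟨ *-congˡ (gauss-fac-fac X+k≤) ⟩
    g₁ * fac k * fac (N ∸ k)
      ≈⟨ gauss-fac-fac k≤N ⟩
    fac N
      ≈⟨ gauss-fac-fac (ℕₚ.m≤m+n X Y) ⟨
    gauss N X * fac X * fac (N ∸ X)
      ≈⟨ *-congˡ (trans (reflexive (cong fac (ℕₚ.m+n∸m≡n X Y))) (sym (fall-fac 2k≤Y))) ⟩
    gauss N X * fac X * (fall Y (k ℕ.+ k) * fac r)
      ≈⟨ solve 4 (λ g x f r → g :* x :* (f :* r) := r :* (x :* (g :* f))) refl _ _ _ _ ⟩
    fac r * (fac X * (gauss N X * fall Y (k ℕ.+ k))) ∎))
    where
    N = X ℕ.+ Y
    r = Y ∸ (k ℕ.+ k)
    g₁ = gauss N k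
    g₂ = gauss (N ∸ k) (X ℕ.+ k)
    k≤Y : k ≤ Y
    k≤Y = ℕₚ.≤-trans (ℕₚ.m≤m+n k k) 2k≤Y
    k≤N : k ≤ N
    k≤N = ℕₚ.≤-trans k≤Y (ℕₚ.m≤n+m Y X)
    X+k≤ : X ℕ.+ k ≤ N ∸ k
    X+k≤ = ℕₚ.m+n≤o⇒m≤o∸n (X ℕ.+ k)
      (ℕₚ.≤-trans (ℕₚ.≤-reflexive (ℕₚ.+-assoc X k k)) (ℕₚ.+-monoʳ-≤ X 2k≤Y))

  -- Links `lucasCoeff` to its closed form and exhibits on the side of θ the same single factor that
  -- 1 - q^(cn) supplies on the trinomial side.
  lucasCoeff-fac : ∀ {n k} → suc k ≤ n →
    lucasCoeff (suc n) (suc k) * fac (suc k) ≈ 1-q^ suc n * fall (n ∸ suc k) k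
  lucasCoeff-fac {n} {k} k<n = begin
    (gauss (n ∸ k) (suc k) + q^ (n ∸ k) * gauss j k) * fac (suc k)
      ≈⟨ solve 5 (λ g x h f y → (g :+ x :* h) :* (f :* y) := g :* (f :* y) :+ x :* (h :* f :* y))
           refl _ _ _ _ _ ⟩
    gauss (n ∸ k) (suc k) * fac (suc k) + q^ (n ∸ k) * (gauss j k * fac k * 1-q^ suc k)
      ≈⟨ +-cong (gauss-fac (n ∸ k) (suc k)) (*-congˡ (*-congʳ (gauss-fac j k))) ⟩
    fall (n ∸ k) (suc k) + q^ (n ∸ k) * (fall j k * 1-q^ suc k)
      ≈⟨ +-congʳ (trans (reflexive (cong (λ i → fall i (suc k)) n∸k≡)) (fall-suc j k)) ⟩
    1-q^ suc j * fall j k + q^ (n ∸ k) * (fall j k * 1-q^ suc k)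
      ≡⟨ cong (λ i → 1-q^ i * fall j k + q^ (n ∸ k) * (fall j k * 1-q^ suc k)) n∸k≡ ⟨
    1-q^ (n ∸ k) * fall j k + q^ (n ∸ k) * (fall j k * 1-q^ suc k)
      ≈⟨ solve 3 (λ x f y → (con 1ℤ :- x) :* f :+ x :* (f :* (con 1ℤ :- y)) := (con 1ℤ :- y :* x) :* f)
           refl _ _ _ ⟩
    (𝟙 - q^ suc k * q^ (n ∸ k)) * fall j k
      ≈⟨ *-congʳ (+-congˡ (-‿cong (q^-∸ (ℕₚ.m≤n⇒m≤1+n k<n)))) ⟨
    1-q^ suc n * fall j k ∎
    where
    j = n ∸ suc k
    n∸k≡ : n ∸ k ≡ suc j
    n∸k≡ = ℕₚ.+-∸-assoc 1 k<n

  triTerm : ℕ → ℕ → ℕ → Carrier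
  triTerm X Y k = q^ (k ℕ.* (k ℕ.+ X)) * gauss (X ℕ.+ Y) k * gauss (X ℕ.+ Y ∸ k) (X ℕ.+ k)

  -- Once `fac` and `rise` clear the denominators, both summands are 1 - qⁿ times the Gaussian
  -- polynomial times a cofactor, `U` or `V`. A congruence of the cofactors modulo 1 - qⁿ therefore
  -- yields one modulo the square.
  triTerm-lucasTerm : ∀ n′ b c′ k → suc k ℕ.+ suc k ≤ suc n′ →
    let n = suc n′ ; X = b ℕ.* n ; Y = suc c′ ℕ.* n in
    ∃[ z ] (triTerm X Y (suc k) - ι (+ suc c′) * gauss (X ℕ.+ Y) X * lucasTerm n (suc k))
             * (fac (suc k) * rise X (suc k))
           ≈ 1-q^ n * 1-q^ n * z
  triTerm-lucasTerm n′ b c′ k 2κ≤n = B * z , (begin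
    (triTerm X Y κ - C * B * lucasTerm n κ) * (fac κ * rise X κ)
      ≈⟨ solve 10 (λ e g h C B s t l f r →
            (e :* g :* h :- C :* B :* (s :* t :* l)) :* (f :* r)
              := e :* (g :* h :* (f :* r)) :- C :* B :* (s :* t) :* (l :* f) :* r)
           refl (q^ (κ ℕ.* (κ ℕ.+ X))) (gauss (X ℕ.+ Y) κ) (gauss (X ℕ.+ Y ∸ κ) (X ℕ.+ κ))
             C B (sgn κ) (q^ tri κ) (lucasCoeff n κ) (fac κ) (rise X κ) ⟩
    e * (gauss (X ℕ.+ Y) κ * gauss (X ℕ.+ Y ∸ κ) (X ℕ.+ κ) * (fac κ * rise X κ))
      - C * B * (sgn κ * q^ tri κ) * (lucasCoeff n κ * fac κ) * rise X κ
      ≈⟨ +-cong (*-congˡ (trans (trinomial-fac X Y κ 2κ≤Y) (*-congˡ fallY)))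
                (-‿cong (*-congʳ (*-congˡ (lucasCoeff-fac κ≤n′)))) ⟩
    e * (B * (D * geom n′ c * fall Y′ (κ ℕ.+ k)))
      - C * B * (sgn κ * q^ tri κ) * (D * F) * rise X κ
      ≈⟨ solve 10 (λ e B D g f C s t F r →
            e :* (B :* (D :* g :* f)) :- C :* B :* (s :* t) :* (D :* F) :* r
              := D :* B :* (e :* g :* f) :- D :* B :* (C :* (s :* t) :* F :* r))
           refl e B D (geom n′ c) (fall Y′ (κ ℕ.+ k)) C (sgn κ) (q^ tri κ) F (rise X κ) ⟩
    D * B * U - D * B * V
      ≈⟨ +-congʳ (*-congˡ U≈) ⟩
    D * B * (V + D * z) - D * B * V
      ≈⟨ solve 4 (λ D B V z → D :* B :* (V :+ D :* z) :- D :* B :* V := D :* D :* (B :* z)) refl D B V z ⟩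
    D * D * (B * z) ∎)
    where
    n = suc n′
    c = suc c′
    κ = suc k
    X = b ℕ.* n
    Y = c ℕ.* n
    -- This is Y - 1: the factors of `fall Y` left after 1 - q^Y has been split off.
    Y′ = c′ ℕ.* n ℕ.+ n′
    D = 1-q^ n
    C = ι (+ c)
    B = gauss (X ℕ.+ Y) X
    e = q^ (κ ℕ.* (κ ℕ.+ X))
    F = fall (n′ ∸ κ) k
    U = e * geom n′ c * fall Y′ (κ ℕ.+ k)
    V = C * (sgn κ * q^ tri κ) * F * rise X κ

    -- The truncation enters here: the 2κ - 1 remaining exponents are cn - j with 0 < j < n.
    κ+k≤n′ : κ ℕ.+ k ≤ n′
    κ+k≤n′ = ℕ.s≤s⁻¹ (≡.subst (_≤ n) (cong suc (ℕₚ.+-suc k k)) 2κ≤n)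
    κ≤n′ : κ ≤ n′
    κ≤n′ = ℕₚ.≤-trans (ℕₚ.m≤m+n κ k) κ+k≤n′
    2κ≤Y : κ ℕ.+ κ ≤ Y
    2κ≤Y = ℕₚ.≤-trans 2κ≤n (ℕₚ.m≤m+n n (c′ ℕ.* n))

    fallY : fall Y (κ ℕ.+ κ) ≈ D * geom n′ c * fall Y′ (κ ℕ.+ k)
    fallY = begin
      fall Y (κ ℕ.+ κ)
        ≡⟨ cong₂ fall (cong suc (ℕₚ.+-comm n′ (c′ ℕ.* n))) (ℕₚ.+-suc κ k) ⟩
      fall (suc Y′) (suc (κ ℕ.+ k))
        ≈⟨ fall-suc Y′ (κ ℕ.+ k) ⟩
      1-q^ suc Y′ * fall Y′ (κ ℕ.+ k)
        ≡⟨ cong (λ i → 1-q^ suc i * fall Y′ (κ ℕ.+ k)) (ℕₚ.+-comm (c′ ℕ.* n) n′) ⟩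
      1-q^ Y * fall Y′ (κ ℕ.+ k)
        ≈⟨ *-congʳ (1-q^cn n′ c) ⟩
      D * geom n′ c * fall Y′ (κ ℕ.+ k) ∎

    open Modulo D

    -- In κ² + κbn the second part is a multiple of n and drops out; κ² splits into two triangular
    -- numbers.
    e∼ : e ∼ q^ tri (suc κ) * q^ tri κ
    e∼ = ∼-trans (≈⇒∼ (begin
        q^ (κ ℕ.* (κ ℕ.+ b ℕ.* n))
          ≡⟨ cong q^_ (≡.trans (ℕₚ.*-distribˡ-+ κ κ (b ℕ.* n))
               (cong₂ ℕ._+_ (≡.sym (tri+tri≡k*k κ)) (≡.sym (ℕₚ.*-assoc κ b n)))) ⟩
        q^ (tri (suc κ) ℕ.+ tri κ ℕ.+ κ ℕ.* b ℕ.* n)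
          ≈⟨ q^-+ (tri (suc κ) ℕ.+ tri κ) (κ ℕ.* b ℕ.* n) ⟩
        q^ (tri (suc κ) ℕ.+ tri κ) * q^ (κ ℕ.* b ℕ.* n)
          ≈⟨ *-congʳ (q^-+ (tri (suc κ)) (tri κ)) ⟩
        q^ tri (suc κ) * q^ tri κ * q^ (κ ℕ.* b ℕ.* n) ∎))
      (∼-trans (∼-* (≈⇒∼ refl) (q^cn∼1 n′ (κ ℕ.* b)))
        (≈⇒∼ (solve 1 (λ x → x :* con 1ℤ := x) refl _)))

    -- Of the 2κ - 1 factors, the top κ reflect to `sgn κ * fac κ`, and `fac κ` is traded for the
    -- congruent `rise X κ`. The other κ - 1 factors form `F`, which `V` contains too.
    U∼V : U ∼ V
    U∼V =
      ∼-trans (∼-* (∼-* e∼ (geom∼c n′ c)) (∼-trans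
        (fall-mod n′ c′ (κ ℕ.+ k) (ℕₚ.m≤n⇒m≤1+n κ+k≤n′)) (≈⇒∼ (fall-split n′ κ k))))
      (∼-trans (≈⇒∼ (solve 5 (λ u t C f F → u :* t :* C :* (f :* F) := C :* (u :* f) :* t :* F)
                 refl (q^ tri (suc κ)) (q^ tri κ) C (fall n′ κ) F))
      (∼-trans (∼-* (∼-* (∼-* (≈⇒∼ refl) (fall-reflect n′ κ (ℕₚ.m≤n⇒m≤1+n κ≤n′))) (≈⇒∼ refl)) (≈⇒∼ refl))
      (∼-trans (∼-* (∼-* (∼-* (≈⇒∼ refl) (∼-* (≈⇒∼ refl) (∼-sym (rise-mod n′ b κ)))) (≈⇒∼ refl)) (≈⇒∼ refl))
      (≈⇒∼ (solve 5 (λ C s r t F → C :* (s :* r) :* t :* F := C :* (s :* t) :* F :* r)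
                 refl C (sgn κ) (rise X κ) (q^ tri κ) F)))))

    z = _∼_.quotient U∼V
    U≈ = _∼_.equality U∼V

  -- In 1 - C(1 - θ) the summand of θ at k = 0 cancels the inner 1, so the two sides agree exactly
  -- there; every later k adds one difference of summands. `P` is an arbitrary additive property,
  -- which allows each summand its own cleared denominator.
  sumTo-difference : ∀ {p} (P : Carrier → Set p) →
    (∀ {x y} → x ≈ y → P x → P y) → P 0# → (∀ {x y} → P x → P y → P (x + y)) →
    ∀ N C B {t l} → t 0 ≈ B → l 0 ≈ 𝟙 →
    (∀ k → k < N → P (t (suc k) - C * B * l (suc k))) →
    P (sumTo N t - B * (𝟙 - C * (𝟙 - sumTo N l)))
  sumTo-difference P resp P0 P+ zero C B {t} {l} t₀ l₀ h = resp (sym (begin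
    t 0 - B * (𝟙 - C * (𝟙 - l 0))
      ≈⟨ +-cong t₀ (-‿cong (*-congˡ (+-congˡ (-‿cong (*-congˡ (+-congˡ (-‿cong l₀))))))) ⟩
    B - B * (𝟙 - C * (𝟙 - 𝟙))
      ≈⟨ solve 2 (λ b c → b :- b :* (con 1ℤ :- c :* (con 1ℤ :- con 1ℤ)) := con 0ℤ) refl B C ⟩
    ι 0ℤ
      ≈⟨ 0-homo ⟩
    0# ∎)) P0
  sumTo-difference P resp P0 P+ (suc N) C B {t} {l} t₀ l₀ h = resp
    (solve 6 (λ T b c L x y →
        T :- b :* (con 1ℤ :- c :* (con 1ℤ :- L)) :+ (x :- c :* b :* y)
          := T :+ x :- b :* (con 1ℤ :- c :* (con 1ℤ :- (L :+ y))))
      refl (sumTo N t) B C (sumTo N l) (t (suc N)) (l (suc N)))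
    (P+ (sumTo-difference P resp P0 P+ N C B t₀ l₀ (λ k k<N → h k (ℕₚ.m<n⇒m<1+n k<N))) (h N ℕₚ.≤-refl))

-- The ring ℤ[q]

open import Defs
open ≡ using (refl; sym; trans; module ≡-Reasoning)

coef : Poly → ℕ → ℤ
coef []      _       = 0ℤ
coef (a ∷ p) zero    = a
coef (a ∷ p) (suc i) = coef p i

infix 4 _≋_
-- Coefficient lists are not canonical, so equality must ignore trailing zeros. Wrapping it in a
-- record lets both polynomials be inferred from a proof.
record _≋_ (p q : Poly) : Set where
  constructor mk
  field at : ∀ i → coef p i ≡ coef q i
open _≋_ public

≋-refl : ∀ {p} → p ≋ p
≋-refl = mk λ _ → refl

≋-sym : ∀ {p q} → p ≋ q → q ≋ p
≋-sym e = mk λ i → sym (at e i)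

≋-trans : ∀ {p q r} → p ≋ q → q ≋ r → p ≋ r
≋-trans e f = mk λ i → trans (at e i) (at f i)

≡⇒≋ : ∀ {p q} → p ≡ q → p ≋ q
≡⇒≋ refl = ≋-refl

coef-⊕ : ∀ p q i → coef (p ⊕ q) i ≡ coef p i ℤ.+ coef q i
coef-⊕ []      q       i       = sym (ℤₚ.+-identityˡ _)
coef-⊕ (a ∷ p) []      i       = sym (ℤₚ.+-identityʳ _)
coef-⊕ (a ∷ p) (b ∷ q) zero    = refl
coef-⊕ (a ∷ p) (b ∷ q) (suc i) = coef-⊕ p q i

coef-scale : ∀ c p i → coef (scale c p) i ≡ c ℤ.* coef p i
coef-scale c []      i       = sym (ℤₚ.*-zeroʳ c)
coef-scale c (a ∷ p) zero    = refl
coef-scale c (a ∷ p) (suc i) = coef-scale c p i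

coef-neg : ∀ p i → coef (scale -1ℤ p) i ≡ ℤ.- coef p i
coef-neg p i = trans (coef-scale -1ℤ p i) (ℤₚ.-1*i≡-i (coef p i))

coef-⊖ : ∀ p q i → coef (p ⊖ q) i ≡ coef p i ℤ.- coef q i
coef-⊖ p q i = trans (coef-⊕ p (scale -1ℤ q) i) (cong (λ z → coef p i ℤ.+ z) (coef-neg q i))

coef-⊗-zero : ∀ a p q → coef ((a ∷ p) ⊗ q) 0 ≡ a ℤ.* coef q 0
coef-⊗-zero a p q = begin
  coef ((a ∷ p) ⊗ q) 0        ≡⟨ coef-⊕ (scale a q) _ 0 ⟩
  coef (scale a q) 0 ℤ.+ 0ℤ   ≡⟨ ℤₚ.+-identityʳ _ ⟩
  coef (scale a q) 0          ≡⟨ coef-scale a q 0 ⟩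
  a ℤ.* coef q 0              ∎
  where open ≡-Reasoning

coef-⊗-suc : ∀ a p q i →
  coef ((a ∷ p) ⊗ q) (suc i) ≡ a ℤ.* coef q (suc i) ℤ.+ coef (p ⊗ q) i
coef-⊗-suc a p q i = trans (coef-⊕ (scale a q) _ (suc i))
  (cong (λ z → z ℤ.+ coef (p ⊗ q) i) (coef-scale a q (suc i)))

IsZero⇒coef : ∀ {p} → IsZero p → ∀ i → coef p i ≡ 0ℤ
IsZero⇒coef []       i       = refl
IsZero⇒coef (e ∷ es) zero    = e
IsZero⇒coef (e ∷ es) (suc i) = IsZero⇒coef es i

coef⇒IsZero : ∀ p → (∀ i → coef p i ≡ 0ℤ) → IsZero p
coef⇒IsZero []      h = []
coef⇒IsZero (a ∷ p) h = h 0 ∷ coef⇒IsZero p (λ i → h (suc i))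

≋⇒≈ : ∀ {p q} → p ≋ q → p ≈ q
≋⇒≈ {p} {q} e = coef⇒IsZero (p ⊖ q) λ i →
  trans (coef-⊖ p q i) (ℤₚ.i≡j⇒i-j≡0 (at e i))

⊕-cong : ∀ {p p′ q q′} → p ≋ p′ → q ≋ q′ → p ⊕ q ≋ p′ ⊕ q′
⊕-cong {p} {p′} {q} {q′} e f = mk λ i →
  trans (coef-⊕ p q i) (trans (cong₂ ℤ._+_ (at e i) (at f i)) (sym (coef-⊕ p′ q′ i)))

scale-cong : ∀ c {p q} → p ≋ q → scale c p ≋ scale c q
scale-cong c {p} {q} e = mk λ i →
  trans (coef-scale c p i) (trans (cong (c ℤ.*_) (at e i)) (sym (coef-scale c q i)))

∷-cong : ∀ {a b p q} → a ≡ b → p ≋ q → a ∷ p ≋ b ∷ q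
∷-cong e f = mk λ { zero → e ; (suc i) → at f i }

⊕-assoc : ∀ p q r → (p ⊕ q) ⊕ r ≋ p ⊕ (q ⊕ r)
⊕-assoc p q r = mk λ i → begin
  coef ((p ⊕ q) ⊕ r) i                   ≡⟨ coef-⊕ (p ⊕ q) r i ⟩
  coef (p ⊕ q) i ℤ.+ coef r i            ≡⟨ cong (λ z → z ℤ.+ coef r i) (coef-⊕ p q i) ⟩
  coef p i ℤ.+ coef q i ℤ.+ coef r i     ≡⟨ ℤₚ.+-assoc (coef p i) _ _ ⟩
  coef p i ℤ.+ (coef q i ℤ.+ coef r i)   ≡⟨ cong (λ z → coef p i ℤ.+ z) (coef-⊕ q r i) ⟨
  coef p i ℤ.+ coef (q ⊕ r) i            ≡⟨ coef-⊕ p (q ⊕ r) i ⟨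
  coef (p ⊕ (q ⊕ r)) i                   ∎
  where open ≡-Reasoning

⊕-comm : ∀ p q → p ⊕ q ≋ q ⊕ p
⊕-comm p q = mk λ i →
  trans (coef-⊕ p q i) (trans (ℤₚ.+-comm (coef p i) _) (sym (coef-⊕ q p i)))

⊕-identityʳ : ∀ p → p ⊕ [] ≋ p
⊕-identityʳ []      = ≋-refl
⊕-identityʳ (a ∷ p) = ≋-refl

⊕-inverseʳ : ∀ p → p ⊖ p ≋ []
⊕-inverseʳ p = mk λ i → trans (coef-⊖ p p i) (ℤₚ.+-inverseʳ (coef p i))

⊗-congʳ : ∀ p {q q′} → q ≋ q′ → p ⊗ q ≋ p ⊗ q′
⊗-congʳ []      e = ≋-refl
⊗-congʳ (a ∷ p) e = ⊕-cong (scale-cong a e) (∷-cong refl (⊗-congʳ p e))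

⊗-zeroʳ : ∀ p → p ⊗ [] ≋ []
⊗-zeroʳ []      = ≋-refl
⊗-zeroʳ (a ∷ p) = mk λ { zero → refl ; (suc i) → at (⊗-zeroʳ p) i }

-- `_⊗_` recurses on its left factor; this expansion along the right one is what commutativity
-- needs.
⊗-∷ : ∀ p b q → p ⊗ (b ∷ q) ≋ scale b p ⊕ (0ℤ ∷ (p ⊗ q))
⊗-∷ []      b q = mk λ { zero → refl ; (suc i) → refl }
⊗-∷ (a ∷ p) b q = mk λ
  { zero    → cong (λ z → z ℤ.+ 0ℤ) (ℤₚ.*-comm a b)
  ; (suc i) → begin
      coef (scale a q ⊕ p ⊗ (b ∷ q)) i
        ≡⟨ coef-⊕ (scale a q) _ i ⟩
      coef (scale a q) i ℤ.+ coef (p ⊗ (b ∷ q)) i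
        ≡⟨ cong (λ z → coef (scale a q) i ℤ.+ z) (trans (at (⊗-∷ p b q) i) (coef-⊕ (scale b p) _ i)) ⟩
      coef (scale a q) i ℤ.+ (coef (scale b p) i ℤ.+ coef (0ℤ ∷ (p ⊗ q)) i)
        ≡⟨ solve 3 (λ x y z → x :+ (y :+ z) := y :+ (x :+ z)) refl
             (coef (scale a q) i) (coef (scale b p) i) _ ⟩
      coef (scale b p) i ℤ.+ (coef (scale a q) i ℤ.+ coef (0ℤ ∷ (p ⊗ q)) i)
        ≡⟨ cong (λ z → coef (scale b p) i ℤ.+ z) (coef-⊕ (scale a q) _ i) ⟨
      coef (scale b p) i ℤ.+ coef ((a ∷ p) ⊗ q) i
        ≡⟨ coef-⊕ (scale b p) _ i ⟨
      coef (scale b p ⊕ (a ∷ p) ⊗ q) i ∎ }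
  where
  open ≡-Reasoning
  open ℤ-Solver

⊗-comm : ∀ p q → p ⊗ q ≋ q ⊗ p
⊗-comm []      q = ≋-sym (⊗-zeroʳ q)
⊗-comm (a ∷ p) q = ≋-trans
  (⊕-cong (≋-refl {scale a q}) (∷-cong refl (⊗-comm p q)))
  (≋-sym (⊗-∷ q a p))

⊗-cong : ∀ {p p′ q q′} → p ≋ p′ → q ≋ q′ → p ⊗ q ≋ p′ ⊗ q′
⊗-cong {p} {p′} {q} {q′} e f =
  ≋-trans (⊗-congʳ p f)
    (≋-trans (⊗-comm p q′) (≋-trans (⊗-congʳ q′ e) (⊗-comm q′ p′)))

⊗-distribˡ : ∀ p q r → p ⊗ (q ⊕ r) ≋ p ⊗ q ⊕ p ⊗ r
⊗-distribˡ []      q r = ≋-refl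
⊗-distribˡ (a ∷ p) q r = mk λ
  { zero → begin
      coef ((a ∷ p) ⊗ (q ⊕ r)) 0           ≡⟨ coef-⊗-zero a p (q ⊕ r) ⟩
      a ℤ.* coef (q ⊕ r) 0                 ≡⟨ cong (a ℤ.*_) (coef-⊕ q r 0) ⟩
      a ℤ.* (coef q 0 ℤ.+ coef r 0)        ≡⟨ ℤₚ.*-distribˡ-+ a (coef q 0) _ ⟩
      a ℤ.* coef q 0 ℤ.+ a ℤ.* coef r 0    ≡⟨ cong₂ ℤ._+_ (coef-⊗-zero a p q) (coef-⊗-zero a p r) ⟨
      coef ((a ∷ p) ⊗ q) 0 ℤ.+ coef ((a ∷ p) ⊗ r) 0 ≡⟨ coef-⊕ ((a ∷ p) ⊗ q) _ 0 ⟨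
      coef ((a ∷ p) ⊗ q ⊕ (a ∷ p) ⊗ r) 0   ∎
  ; (suc i) → begin
      coef ((a ∷ p) ⊗ (q ⊕ r)) (suc i)
        ≡⟨ coef-⊗-suc a p (q ⊕ r) i ⟩
      a ℤ.* coef (q ⊕ r) (suc i) ℤ.+ coef (p ⊗ (q ⊕ r)) i
        ≡⟨ cong₂ (λ y z → a ℤ.* y ℤ.+ z) (coef-⊕ q r (suc i))
             (trans (at (⊗-distribˡ p q r) i) (coef-⊕ (p ⊗ q) _ i)) ⟩
      a ℤ.* (coef q (suc i) ℤ.+ coef r (suc i)) ℤ.+ (coef (p ⊗ q) i ℤ.+ coef (p ⊗ r) i)
        ≡⟨ solve 5 (λ a x y z w → a :* (x :+ y) :+ (z :+ w) := (a :* x :+ z) :+ (a :* y :+ w))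
             refl a (coef q (suc i)) (coef r (suc i)) (coef (p ⊗ q) i) (coef (p ⊗ r) i) ⟩
      (a ℤ.* coef q (suc i) ℤ.+ coef (p ⊗ q) i) ℤ.+ (a ℤ.* coef r (suc i) ℤ.+ coef (p ⊗ r) i)
        ≡⟨ cong₂ ℤ._+_ (coef-⊗-suc a p q i) (coef-⊗-suc a p r i) ⟨
      coef ((a ∷ p) ⊗ q) (suc i) ℤ.+ coef ((a ∷ p) ⊗ r) (suc i)
        ≡⟨ coef-⊕ ((a ∷ p) ⊗ q) _ (suc i) ⟨
      coef ((a ∷ p) ⊗ q ⊕ (a ∷ p) ⊗ r) (suc i) ∎ }
  where
  open ≡-Reasoning
  open ℤ-Solver

⊗-distribʳ : ∀ r p q → (p ⊕ q) ⊗ r ≋ p ⊗ r ⊕ q ⊗ r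
⊗-distribʳ r p q = ≋-trans (⊗-comm (p ⊕ q) r)
  (≋-trans (⊗-distribˡ r p q) (⊕-cong (⊗-comm r p) (⊗-comm r q)))

scale-⊗ : ∀ c p q → scale c p ⊗ q ≋ scale c (p ⊗ q)
scale-⊗ c []      q = ≋-refl
scale-⊗ c (a ∷ p) q = mk λ
  { zero → begin
      coef (scale c (a ∷ p) ⊗ q) 0      ≡⟨ coef-⊗-zero (c ℤ.* a) (scale c p) q ⟩
      c ℤ.* a ℤ.* coef q 0              ≡⟨ ℤₚ.*-assoc c a _ ⟩
      c ℤ.* (a ℤ.* coef q 0)            ≡⟨ cong (c ℤ.*_) (coef-⊗-zero a p q) ⟨
      c ℤ.* coef ((a ∷ p) ⊗ q) 0        ≡⟨ coef-scale c ((a ∷ p) ⊗ q) 0 ⟨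
      coef (scale c ((a ∷ p) ⊗ q)) 0    ∎
  ; (suc i) → begin
      coef (scale c (a ∷ p) ⊗ q) (suc i)
        ≡⟨ coef-⊗-suc (c ℤ.* a) (scale c p) q i ⟩
      c ℤ.* a ℤ.* coef q (suc i) ℤ.+ coef (scale c p ⊗ q) i
        ≡⟨ cong (λ z → c ℤ.* a ℤ.* coef q (suc i) ℤ.+ z)
             (trans (at (scale-⊗ c p q) i) (coef-scale c (p ⊗ q) i)) ⟩
      c ℤ.* a ℤ.* coef q (suc i) ℤ.+ c ℤ.* coef (p ⊗ q) i
        ≡⟨ solve 4 (λ c a x y → c :* a :* x :+ c :* y := c :* (a :* x :+ y)) refl
             c a (coef q (suc i)) (coef (p ⊗ q) i) ⟩
      c ℤ.* (a ℤ.* coef q (suc i) ℤ.+ coef (p ⊗ q) i)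
        ≡⟨ cong (c ℤ.*_) (coef-⊗-suc a p q i) ⟨
      c ℤ.* coef ((a ∷ p) ⊗ q) (suc i)
        ≡⟨ coef-scale c ((a ∷ p) ⊗ q) (suc i) ⟨
      coef (scale c ((a ∷ p) ⊗ q)) (suc i) ∎ }
  where
  open ≡-Reasoning
  open ℤ-Solver

scale-zero : ∀ p → scale 0ℤ p ≋ []
scale-zero p = mk λ i → trans (coef-scale 0ℤ p i) (ℤₚ.*-zeroˡ (coef p i))

0∷-⊗ : ∀ p q → (0ℤ ∷ p) ⊗ q ≋ 0ℤ ∷ (p ⊗ q)
0∷-⊗ p q = ⊕-cong (scale-zero q) (≋-refl {0ℤ ∷ (p ⊗ q)})

⊗-assoc : ∀ p q r → (p ⊗ q) ⊗ r ≋ p ⊗ (q ⊗ r)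
⊗-assoc []      q r = ≋-refl
⊗-assoc (a ∷ p) q r = ≋-trans (⊗-distribʳ r (scale a q) _)
  (⊕-cong (scale-⊗ a q r)
    (≋-trans (0∷-⊗ (p ⊗ q) r) (∷-cong refl (⊗-assoc p q r))))

const-⊗ : ∀ c p → const c ⊗ p ≋ scale c p
const-⊗ c p = ≋-trans
  (⊕-cong (≋-refl {scale c p}) (mk {0ℤ ∷ []} {[]} λ { zero → refl ; (suc i) → refl }))
  (⊕-identityʳ (scale c p))

⊗-identityˡ : ∀ p → const 1ℤ ⊗ p ≋ p
⊗-identityˡ p = ≋-trans (const-⊗ 1ℤ p)
  (mk λ i → trans (coef-scale 1ℤ p i) (ℤₚ.*-identityˡ (coef p i)))

polyRing : CommutativeRing 0ℓ 0ℓ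
polyRing = record
  { Carrier = Poly
  ; _≈_ = _≋_
  ; _+_ = _⊕_
  ; _*_ = _⊗_
  ; -_  = scale -1ℤ
  ; 0#  = []
  ; 1#  = const 1ℤ
  ; isCommutativeRing = record
    { isRing = record
      { +-isAbelianGroup = record
        { isGroup = record
          { isMonoid = record
            { isSemigroup = record
              { isMagma = record
                { isEquivalence = record { refl = ≋-refl ; sym = ≋-sym ; trans = ≋-trans }
                ; ∙-cong = ⊕-cong
                }
              ; assoc = ⊕-assoc
              }
            ; identity = (λ _ → ≋-refl) , ⊕-identityʳ
            }
          ; inverse = (λ p → ≋-trans (⊕-comm (scale -1ℤ p) p) (⊕-inverseʳ p)) , ⊕-inverseʳ
          ; ⁻¹-cong = scale-cong -1ℤ
          }
        ; comm = ⊕-comm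
        }
      ; *-cong = ⊗-cong
      ; *-assoc = ⊗-assoc
      ; *-identity = ⊗-identityˡ , λ p → ≋-trans (⊗-comm p (const 1ℤ)) (⊗-identityˡ p)
      ; distrib = ⊗-distribˡ , ⊗-distribʳ
      }
    ; *-comm = ⊗-comm
    }
  }

constHom : CommutativeRing.rawRing ℤₚ.+-*-commutativeRing
             -Raw-AlmostCommutative⟶ fromCommutativeRing polyRing
constHom = record
  { ⟦_⟧    = const
  ; +-homo = λ _ _ → ≋-refl
  ; *-homo = λ a b → ≋-sym (const-⊗ a (const b))
  ; -‿homo = λ a → ∷-cong (sym (ℤₚ.-1*i≡-i a)) ≋-refl
  ; 0-homo = mk λ { zero → refl ; (suc i) → refl }
  ; 1-homo = ≋-refl
  }

X^-+ : ∀ m n → X^ (m ℕ.+ n) ≋ X^ m ⊗ X^ n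
X^-+ zero    n = ≋-sym (⊗-identityˡ (X^ n))
X^-+ (suc m) n = ≋-trans (∷-cong refl (X^-+ m n)) (≋-sym (0∷-⊗ (X^ m) (X^ n)))

-- The lowest coefficient of the product is the lowest coefficient of p.
coef₀≡1⇒regular : ∀ u p → (1ℤ ∷ u) ⊗ p ≋ [] → p ≋ []
coef₀≡1⇒regular u []      e = ≋-refl
coef₀≡1⇒regular u (b ∷ p) e = mk λ { zero → b≡0 ; (suc i) → at (coef₀≡1⇒regular u p e′) i }
  where
  b≡0 : b ≡ 0ℤ
  b≡0 = trans (sym (ℤₚ.*-identityˡ b)) (trans (sym (coef-⊗-zero 1ℤ u (b ∷ p))) (at e 0))
  e″ : 0ℤ ∷ ((1ℤ ∷ u) ⊗ p) ≋ []
  e″ = ≋-trans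
    (⊕-cong (≋-sym (≋-trans (≡⇒≋ (cong (λ z → scale z (1ℤ ∷ u)) b≡0)) (scale-zero (1ℤ ∷ u))))
            (≋-refl {0ℤ ∷ ((1ℤ ∷ u) ⊗ p)}))
    (≋-trans (≋-sym (⊗-∷ (1ℤ ∷ u) b p)) e)
  e′ : (1ℤ ∷ u) ⊗ p ≋ []
  e′ = mk λ i → at e″ (suc i)

1-X^-regular : ∀ j p → (const 1ℤ ⊖ X^ (suc j)) ⊗ p ≋ [] → p ≋ []
1-X^-regular j p = coef₀≡1⇒regular (scale -1ℤ (X^ j)) p

-- Monic polynomials and exact division

coef-≥ : ∀ p {i} → length p ≤ i → coef p i ≡ 0ℤ
coef-≥ []      le       = refl
coef-≥ (a ∷ p) (s≤s le) = coef-≥ p le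

coef-∷ʳ : ∀ p c → coef (p ∷ʳ c) (length p) ≡ c
coef-∷ʳ []      c = refl
coef-∷ʳ (a ∷ p) c = coef-∷ʳ p c

++-zeros : ∀ p {z} → IsZero z → p ++ z ≋ p
++-zeros []      h = mk (IsZero⇒coef h)
++-zeros (a ∷ p) h = ∷-cong refl (++-zeros p h)

norm-≋ : ∀ p → norm p ≋ p
norm-≋ p = ≋-sym (subst (_≋ norm p) p≡ (++-zeros (norm p) zeros))
  where
  tW = takeWhile (ℤ._≟ 0ℤ) (reverse p)
  dW = dropWhile (ℤ._≟ 0ℤ) (reverse p)
  zeros : IsZero (reverse tW)
  zeros = All-resp-↭ (↭-sym (↭-reverse tW)) (Allₚ.all-takeWhile (ℤ._≟ 0ℤ) (reverse p))
  p≡ : reverse dW ++ reverse tW ≡ p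
  p≡ = trans (sym (Listₚ.reverse-++ tW dW))
    (trans (cong reverse (Listₚ.takeWhile++dropWhile (ℤ._≟ 0ℤ) (reverse p)))
           (Listₚ.reverse-involutive p))

-- The last entry of a non-empty `norm p` is non-zero by `dropWhile`, and it is a coefficient of p,
-- so its index must lie below b.
length-norm : ∀ p {b} → (∀ {i} → b ≤ i → coef p i ≡ 0ℤ) → length (norm p) ≤ b
length-norm p {b} h
  with dropWhile (ℤ._≟ 0ℤ) (reverse p) | Allₚ.all-head-dropWhile (ℤ._≟ 0ℤ) (reverse p) | norm-≋ p
... | []    | _        | _ = z≤n
... | c ∷ r | just c≢0 | e with suc (length r) ≤? b
...   | yes le = subst (_≤ b) (sym (Listₚ.length-reverse (c ∷ r))) le
...   | no nle = ⊥-elim (c≢0 (begin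
  c                                           ≡⟨ coef-∷ʳ (reverse r) c ⟨
  coef (reverse r ∷ʳ c) (length (reverse r))  ≡⟨ cong₂ coef (Listₚ.unfold-reverse c r) (sym (Listₚ.length-reverse r)) ⟨
  coef (reverse (c ∷ r)) (length r)           ≡⟨ at e (length r) ⟩
  coef p (length r)                           ≡⟨ h (ℕ.s≤s⁻¹ (ℕₚ.≰⇒> nle)) ⟩
  0ℤ                                          ∎))
  where open ≡-Reasoning

leadCoeff-coef : ∀ p {l} → length p ≡ suc l → leadCoeff p ≡ coef p l
leadCoeff-coef p {l} len with initLast p
... | xs ∷ʳ′ x rewrite Listₚ.reverse-++ xs (x ∷ []) = sym (subst (λ i → coef (xs ∷ʳ x) i ≡ x)
  (ℕₚ.suc-injective (trans (sym (trans (Listₚ.length-++ xs) (ℕₚ.+-comm (length xs) 1))) len))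
  (coef-∷ʳ xs x))

Above0 : ℕ → Poly → Set
Above0 e p = ∀ {i} → e < i → coef p i ≡ 0ℤ

0∷≋[] : ∀ {p} → p ≋ [] → 0ℤ ∷ p ≋ []
0∷≋[] e = mk λ { zero → refl ; (suc i) → at e i }

⊗-constant : ∀ a p q → p ≋ [] → (a ∷ p) ⊗ q ≋ scale a q
⊗-constant a p q e = ≋-trans (⊕-cong (≋-refl {scale a q}) (0∷≋[] (⊗-cong e (≋-refl {q})))) (⊕-identityʳ (scale a q))

Above0-tail : ∀ {e a p} → Above0 (suc e) (a ∷ p) → Above0 e p
Above0-tail h lt = h (s<s lt)

coef-⊗-top : ∀ p q {e f} → Above0 e p → Above0 f q →
  coef (p ⊗ q) (e ℕ.+ f) ≡ coef p e ℤ.* coef q f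
coef-⊗-top []      q {e}     {f} hp hq = sym (ℤₚ.*-zeroˡ (coef q f))
coef-⊗-top (a ∷ p) q {zero}  {f} hp hq =
  trans (at (⊗-constant a p q (mk λ i → hp z<s)) f) (coef-scale a q f)
coef-⊗-top (a ∷ p) q {suc e} {f} hp hq = begin
  coef ((a ∷ p) ⊗ q) (suc (e ℕ.+ f))
    ≡⟨ coef-⊗-suc a p q (e ℕ.+ f) ⟩
  a ℤ.* coef q (suc (e ℕ.+ f)) ℤ.+ coef (p ⊗ q) (e ℕ.+ f)
    ≡⟨ cong₂ ℤ._+_ (trans (cong (a ℤ.*_) (hq (s≤s (ℕₚ.m≤n+m f e)))) (ℤₚ.*-zeroʳ a))
         (coef-⊗-top p q (Above0-tail {a = a} {p} hp) hq) ⟩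
  0ℤ ℤ.+ coef p e ℤ.* coef q f
    ≡⟨ ℤₚ.+-identityˡ _ ⟩
  coef p e ℤ.* coef q f ∎
  where open ≡-Reasoning

Above0-⊗ : ∀ p q {e f} → Above0 e p → Above0 f q → Above0 (e ℕ.+ f) (p ⊗ q)
Above0-⊗ []      q             hp hq lt = refl
Above0-⊗ (a ∷ p) q {zero}  {f} hp hq {i} lt =
  trans (at (⊗-constant a p q (mk λ i → hp z<s)) i)
    (trans (coef-scale a q i) (trans (cong (a ℤ.*_) (hq lt)) (ℤₚ.*-zeroʳ a)))
Above0-⊗ (a ∷ p) q {suc e} {f} hp hq {suc i} (s<s lt) = trans (coef-⊗-suc a p q i)
  (cong₂ ℤ._+_ (trans (cong (a ℤ.*_) (hq (s≤s (ℕₚ.<⇒≤ (ℕₚ.≤-<-trans (ℕₚ.m≤n+m f e) lt))))) (ℤₚ.*-zeroʳ a))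
    (Above0-⊗ p q (Above0-tail {a = a} {p} hp) hq lt))

record Monic (p : Poly) : Set where
  constructor monic
  field
    deg   : ℕ
    lead  : coef p deg ≡ 1ℤ
    above : Above0 deg p
open Monic

Monic-resp : ∀ {p q} → p ≋ q → Monic p → Monic q
Monic-resp e (monic d l a) = monic d (trans (sym (at e d)) l) (λ {i} lt → trans (sym (at e i)) (a lt))

Monic-⊗ : ∀ {p q} → Monic p → Monic q → Monic (p ⊗ q)
Monic-⊗ {p} {q} (monic e lp ap) (monic f lq aq) = monic (e ℕ.+ f)
  (trans (coef-⊗-top p q ap aq) (cong₂ ℤ._*_ lp lq)) (Above0-⊗ p q ap aq)

Monic-1 : Monic (const 1ℤ)
Monic-1 = monic 0 refl λ { {suc i} _ → refl }

length-X^ : ∀ s → length (X^ s) ≡ suc s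
length-X^ zero    = refl
length-X^ (suc s) = cong suc (length-X^ s)

Monic-X^ : ∀ s → Monic (X^ s)
Monic-X^ s = monic s (top s) (λ {i} lt → coef-≥ (X^ s) (subst (_≤ i) (sym (length-X^ s)) lt))
  where
  top : ∀ s → coef (X^ s) s ≡ 1ℤ
  top zero    = refl
  top (suc s) = top s

Monic-X^-1 : ∀ n → Monic (X^ (suc n) ⊖ const 1ℤ)
Monic-X^-1 n = monic (suc n) (eq z<s (lead (Monic-X^ (suc n))))
  λ { {suc i} lt → eq z<s (above (Monic-X^ (suc n)) lt) }
  where
  eq : ∀ {i z} → 0 < i → coef (X^ (suc n)) i ≡ z → coef (X^ (suc n) ⊖ const 1ℤ) i ≡ z
  eq {suc i} _ h = trans (coef-⊖ (X^ (suc n)) (const 1ℤ) (suc i)) (trans (ℤₚ.+-identityʳ _) h)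

degree? : ∀ p → p ≋ [] ⊎ ∃[ f ] coef p f ≢ 0ℤ × Above0 f p
degree? []      = inj₁ ≋-refl
degree? (a ∷ p) with degree? p | a ℤ.≟ 0ℤ
... | inj₂ (f , nz , ab) | _        = inj₂ (suc f , nz , λ { {suc i} (s<s lt) → ab lt })
... | inj₁ e             | yes refl = inj₁ (0∷≋[] e)
... | inj₁ e             | no nz    = inj₂ (0 , nz , λ { {suc i} _ → at e i })

-- The top coefficient of q survives as the top coefficient of the product, so the degrees add up
-- and that coefficient is 1.
Monic-cancel : ∀ {p} q → Monic p → Monic (p ⊗ q) → Monic q
Monic-cancel {p} q (monic e lp ap) (monic n ln an) with degree? q
... | inj₁ e≋ = ⊥-elim (0≢1 (trans (sym (at (≋-trans (⊗-congʳ p e≋) (⊗-zeroʳ p)) n)) ln))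
  where
  0≢1 : 0ℤ ≢ 1ℤ
  0≢1 ()
... | inj₂ (f , nz , af) = monic f (trans (sym top) (trans (cong (coef (p ⊗ q)) e+f≡n) ln)) af
  where
  top : coef (p ⊗ q) (e ℕ.+ f) ≡ coef q f
  top = trans (coef-⊗-top p q ap af) (trans (cong (ℤ._* coef q f) lp) (ℤₚ.*-identityˡ _))
  e+f≡n : e ℕ.+ f ≡ n
  e+f≡n with ℕₚ.<-cmp (e ℕ.+ f) n
  ... | tri≈ _ eq _ = eq
  ... | tri> _ _ gt = ⊥-elim (nz (trans (sym top) (an gt)))
  ... | tri< lt _ _ with trans (sym (Above0-⊗ p q ap af lt)) ln
  ...   | ()

Monic-⊗-small : ∀ {p} q (m : Monic p) → (∀ {i} → deg m ≤ i → coef (p ⊗ q) i ≡ 0ℤ) → q ≋ []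
Monic-⊗-small {p} q (monic e lp ap) small with degree? q
... | inj₁ e≋ = e≋
... | inj₂ (f , nz , af) = ⊥-elim (nz (begin
  coef q f                   ≡⟨ ℤₚ.*-identityˡ _ ⟨
  1ℤ ℤ.* coef q f            ≡⟨ cong (ℤ._* coef q f) lp ⟨
  coef p e ℤ.* coef q f      ≡⟨ coef-⊗-top p q ap af ⟨
  coef (p ⊗ q) (e ℕ.+ f)     ≡⟨ small (ℕₚ.m≤m+n e f) ⟩
  0ℤ                         ∎))
  where open ≡-Reasoning

scale-⊗-top : ∀ c s d {e} → coef d e ≡ 1ℤ → Above0 e d →
  coef (scale c (X^ s ⊗ d)) (s ℕ.+ e) ≡ c
scale-⊗-top c s d {e} ld ad = trans (coef-scale c (X^ s ⊗ d) (s ℕ.+ e))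
  (trans (cong (c ℤ.*_) (trans (coef-⊗-top (X^ s) d (above (Monic-X^ s)) ad)
    (cong₂ ℤ._*_ (lead (Monic-X^ s)) ld))) (ℤₚ.*-identityʳ c))

open CommutativeRing polyRing using (setoid; *-commutativeSemigroup)
open import Algebra.Properties.CommutativeSemigroup.Divisibility *-commutativeSemigroup
  using (_,_) renaming (_∣_ to _∣ᵖ_; ∣-trans to ∣ᵖ-trans; ∙-cong-∣ to ∣ᵖ-*)

open import Algebra.Definitions.RawMagma (CommutativeRing.*-rawMagma polyRing)
  using (module _∣ʳ_)

open RingSolver (CommutativeRing.rawRing ℤₚ.+-*-commutativeRing) (fromCommutativeRing polyRing) constHom
  (λ a b → Maybe.map (≡⇒≋ ∘ cong const) (dec⇒maybe (a ℤₚ.≟ b)))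
  using (solve; _:=_; _:+_; _:*_; _:-_; :-_; con)
module ≋-Reasoning = SetoidReasoning setoid

-- As d has leading coefficient 1, the leading coefficient of the dividend is itself the next
-- coefficient of the quotient. Each subtraction shortens the normalised dividend, so fuel equal to
-- its length suffices.
divMonic-spec : ∀ f p d e → length d ≡ suc e → coef d e ≡ 1ℤ → length (norm p) ≤ f →
  ∃[ r ] p ≋ divMonic f p d ⊗ d ⊕ r × length r ≤ e
divMonic-spec zero    p d e len ld fuel with norm p | norm-≋ p
... | [] | p≋ = [] , ≋-sym p≋ , z≤n
divMonic-spec (suc f) p d e len ld fuel with norm p | norm-≋ p
... | p′ | p′≋p with length d ≤? length p′
...   | no d≰p′ = p′ , ≋-sym p′≋p , ℕ.s≤s⁻¹ (subst (length p′ <_) len (ℕₚ.≰⇒> d≰p′))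
...   | yes d≤p′ = r , p≋ , r≤e
  where
  ad : Above0 e d
  ad lt = coef-≥ d (subst (_≤ _) (sym len) lt)
  s = length p′ ∸ length d
  c = leadCoeff p′
  p″ = p′ ⊖ scale c (X^ s ⊗ d)
  length-p′ : length p′ ≡ suc (s ℕ.+ e)
  length-p′ = trans (sym (ℕₚ.m∸n+n≡m d≤p′)) (trans (cong (s ℕ.+_) len) (ℕₚ.+-suc s e))
  -- At index s + e the leading terms cancel; above it both polynomials already vanish.
  small : ∀ {i} → s ℕ.+ e ≤ i → coef p″ i ≡ 0ℤ
  small {i} le with ℕₚ.m≤n⇒m<n∨m≡n le
  ... | inj₁ lt = trans (coef-⊖ p′ _ i) (cong₂ ℤ._-_
          (coef-≥ p′ (subst (_≤ i) (sym length-p′) lt))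
          (trans (coef-scale c (X^ s ⊗ d) i)
            (trans (cong (c ℤ.*_) (Above0-⊗ (X^ s) d (above (Monic-X^ s)) ad lt)) (ℤₚ.*-zeroʳ c))))
  ... | inj₂ refl = trans (coef-⊖ p′ _ i) (trans
          (cong₂ ℤ._-_ (sym (leadCoeff-coef p′ length-p′)) (scale-⊗-top c s d ld ad))
          (ℤₚ.+-inverseʳ c))
  rec = divMonic-spec f p″ d e len ld
    (ℕₚ.≤-trans (length-norm p″ small) (ℕ.s≤s⁻¹ (subst (_≤ suc f) length-p′ fuel)))
  r = proj₁ rec
  r≤e = proj₂ (proj₂ rec)
  S = divMonic f p″ d
  open ≋-Reasoning
  p≋ : p ≋ (scale c (X^ s) ⊕ S) ⊗ d ⊕ r
  p≋ = begin
    p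
      ≈⟨ ≋-sym p′≋p ⟩
    p′
      ≈⟨ solve 2 (λ x y → x := x :- y :+ y) ≋-refl p′ (scale c (X^ s ⊗ d)) ⟩
    p″ ⊕ scale c (X^ s ⊗ d)
      ≈⟨ ⊕-cong (proj₁ (proj₂ rec)) (≋-sym (scale-⊗ c (X^ s) d)) ⟩
    S ⊗ d ⊕ r ⊕ scale c (X^ s) ⊗ d
      ≈⟨ solve 4 (λ S d r t → S :* d :+ r :+ t :* d := (t :+ S) :* d :+ r) ≋-refl S d r (scale c (X^ s)) ⟩
    (scale c (X^ s) ⊕ S) ⊗ d ⊕ r ∎

const-regular : ∀ {c} → c ≢ 0ℤ → ∀ p → const c ⊗ p ≋ [] → p ≋ []
const-regular {c} c≢0 p e = mk λ i → eq (at (≋-trans (≋-sym (const-⊗ c p)) e) i)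
  where
  eq : ∀ {i} → coef (scale c p) i ≡ 0ℤ → coef p i ≡ 0ℤ
  eq {i} h with ℤₚ.i*j≡0⇒i≡0∨j≡0 c (trans (sym (coef-scale c p i)) h)
  ... | inj₁ c≡0 = ⊥-elim (c≢0 c≡0)
  ... | inj₂ z   = z

-- The remainder of p, times c, is a multiple of d of too small a degree.
divMonic-exact : ∀ {d} (m : Monic d) f p c → c ≢ 0ℤ → d ∣ᵖ const c ⊗ p → length (norm p) ≤ f →
  divMonic f p (norm d) ⊗ d ≋ p
divMonic-exact {d} m@(monic e ld ad) f p c c≢0 (w , w⊗d≋) fuel = begin
  S ⊗ d            ≈⟨ ⊗-congʳ S (norm-≋ d) ⟨
  S ⊗ norm d       ≈⟨ ⊕-identityʳ _ ⟨
  S ⊗ norm d ⊕ []  ≈⟨ ⊕-cong (≋-refl {S ⊗ norm d}) r≋0 ⟨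
  S ⊗ norm d ⊕ r   ≈⟨ p≋ ⟨
  p                ∎
  where
  open ≋-Reasoning
  length-d : length (norm d) ≡ suc e
  length-d = ℕₚ.≤-antisym (length-norm d ad) (ℕₚ.≰⇒> λ le → 0≢1 (trans (sym (coef-≥ (norm d) le)) (trans (at (norm-≋ d) e) ld)))
    where
    0≢1 : 0ℤ ≢ 1ℤ
    0≢1 ()
  S = divMonic f p (norm d)
  spec = divMonic-spec f p (norm d) e length-d (trans (at (norm-≋ d) e) ld) fuel
  r = proj₁ spec
  p≋ = proj₁ (proj₂ spec)
  r≤e = proj₂ (proj₂ spec)
  T = w ⊖ const c ⊗ S
  cr≋ : const c ⊗ r ≋ d ⊗ T
  cr≋ = begin
    const c ⊗ r
      ≈⟨ solve 4 (λ c r S d → c :* r := c :* (S :* d :+ r) :- c :* S :* d) ≋-refl (const c) r S d ⟩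
    const c ⊗ (S ⊗ d ⊕ r) ⊖ const c ⊗ S ⊗ d
      ≈⟨ ⊕-cong (⊗-congʳ (const c) (⊕-cong (⊗-congʳ S (norm-≋ d)) (≋-refl {r}))) (≋-refl {scale -1ℤ (const c ⊗ S ⊗ d)}) ⟨
    const c ⊗ (S ⊗ norm d ⊕ r) ⊖ const c ⊗ S ⊗ d
      ≈⟨ ⊕-cong (≋-trans w⊗d≋ (⊗-congʳ (const c) p≋)) (≋-refl {scale -1ℤ (const c ⊗ S ⊗ d)}) ⟨
    w ⊗ d ⊖ const c ⊗ S ⊗ d
      ≈⟨ solve 4 (λ w d c S → w :* d :- c :* S :* d := d :* (w :- c :* S)) ≋-refl w d (const c) S ⟩
    d ⊗ T ∎
  T≋0 : T ≋ []
  T≋0 = Monic-⊗-small T m λ {i} e≤i → trans (sym (at cr≋ i))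
    (trans (at (const-⊗ c r) i) (trans (coef-scale c r i)
      (trans (cong (c ℤ.*_) (coef-≥ r (ℕₚ.≤-trans r≤e e≤i))) (ℤₚ.*-zeroʳ c))))
  r≋0 : r ≋ []
  r≋0 = const-regular c≢0 r (≋-trans cr≋ (≋-trans (⊗-congʳ d T≋0) (⊗-zeroʳ d)))

-- Coprimality up to a non-zero constant

infix 4 _⊥_
-- Bézout's identity over ℚ[q] with denominators cleared. The value cannot be required to be 1:
-- combinations of 1 - q and 1 + q over ℤ reach 2, but not 1.
record _⊥_ (P F : Poly) : Set where
  constructor coprime
  field
    {U V}   : Poly
    {value} : ℤ
    value≢0 : value ≢ 0ℤ
    bezout  : U ⊗ P ⊕ V ⊗ F ≋ const value

⊥⇒Coprime : ∀ {P F} → P ⊥ F → Coprime P F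
⊥⇒Coprime (coprime {U} {V} {c} nz e) = U , V , c , nz , ≋⇒≈ e

⊥-sym : ∀ {P F} → P ⊥ F → F ⊥ P
⊥-sym {P} {F} (coprime {U} {V} nz e) = coprime {U = V} {V = U} nz (≋-trans (⊕-comm (V ⊗ F) (U ⊗ P)) e)

1-⊥ : ∀ F → const 1ℤ ⊥ F
1-⊥ F = coprime {U = const 1ℤ} {V = const 0ℤ} {value = 1ℤ} (λ ())
  (solve 1 (λ F → con 1ℤ :* con 1ℤ :+ con 0ℤ :* F := con 1ℤ) ≋-refl F)

⊥-∣ : ∀ {P Q F} → P ∣ᵖ Q → Q ⊥ F → P ⊥ F
⊥-∣ {P} {Q} {F} (w , e) (coprime {U} {V} nz b) = coprime {U = U ⊗ w} {V = V} nz
  (≋-trans (⊕-cong (≋-trans (⊗-assoc U w P) (⊗-congʳ U e)) (≋-refl {V ⊗ F})) b)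

-- In the product of the two Bézout identities every term except the one with P Q contains F.
⊥-⊗ : ∀ {P Q F} → P ⊥ F → Q ⊥ F → P ⊗ Q ⊥ F
⊥-⊗ {P} {Q} {F} (coprime {U} {V} {c} c≢0 e) (coprime {U′} {V′} {c′} c′≢0 e′) =
  coprime {U = U ⊗ U′} {V = U ⊗ P ⊗ V′ ⊕ V ⊗ (U′ ⊗ Q ⊕ V′ ⊗ F)} {value = c ℤ.* c′} nz (begin
    U ⊗ U′ ⊗ (P ⊗ Q) ⊕ (U ⊗ P ⊗ V′ ⊕ V ⊗ (U′ ⊗ Q ⊕ V′ ⊗ F)) ⊗ F
      ≈⟨ solve 7 (λ U U′ P Q V V′ F →
           U :* U′ :* (P :* Q) :+ (U :* P :* V′ :+ V :* (U′ :* Q :+ V′ :* F)) :* F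
             := (U :* P :+ V :* F) :* (U′ :* Q :+ V′ :* F)) ≋-refl U U′ P Q V V′ F ⟩
    (U ⊗ P ⊕ V ⊗ F) ⊗ (U′ ⊗ Q ⊕ V′ ⊗ F)
      ≈⟨ ⊗-cong e e′ ⟩
    const c ⊗ const c′
      ≈⟨ const-⊗ c (const c′) ⟩
    const (c ℤ.* c′) ∎)
  where
  open ≋-Reasoning
  nz : c ℤ.* c′ ≢ 0ℤ
  nz z with ℤₚ.i*j≡0⇒i≡0∨j≡0 c z
  ... | inj₁ c≡0  = c≢0 c≡0
  ... | inj₂ c′≡0 = c′≢0 c′≡0

-- Multiply the Bézout identity of P and Q by cF: in the term with P write F as a multiple of Q, in
-- the term with Q write cF as a multiple of P. The Bézout value joins the constant.
⊥-lcm : ∀ {P Q F c} → P ⊥ Q → c ≢ 0ℤ → P ∣ᵖ const c ⊗ F → Q ∣ᵖ F →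
  ∃[ c′ ] c′ ≢ 0ℤ × P ⊗ Q ∣ᵖ const c′ ⊗ F
⊥-lcm {P} {Q} {F} {c} (coprime {U} {V} {a} a≢0 e) c≢0 (w , ew) (v , ev) =
  a ℤ.* c , nz , (const c ⊗ U ⊗ v ⊕ V ⊗ w) , (begin
    (const c ⊗ U ⊗ v ⊕ V ⊗ w) ⊗ (P ⊗ Q)
      ≈⟨ solve 7 (λ c U v V w P Q →
           (c :* U :* v :+ V :* w) :* (P :* Q) := c :* (U :* P) :* (v :* Q) :+ V :* Q :* (w :* P))
           ≋-refl (const c) U v V w P Q ⟩
    const c ⊗ (U ⊗ P) ⊗ (v ⊗ Q) ⊕ V ⊗ Q ⊗ (w ⊗ P)
      ≈⟨ ⊕-cong (⊗-congʳ (const c ⊗ (U ⊗ P)) ev) (⊗-congʳ (V ⊗ Q) ew) ⟩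
    const c ⊗ (U ⊗ P) ⊗ F ⊕ V ⊗ Q ⊗ (const c ⊗ F)
      ≈⟨ solve 6 (λ c U P V Q F →
           c :* (U :* P) :* F :+ V :* Q :* (c :* F) := (U :* P :+ V :* Q) :* c :* F)
           ≋-refl (const c) U P V Q F ⟩
    (U ⊗ P ⊕ V ⊗ Q) ⊗ const c ⊗ F
      ≈⟨ ⊗-cong (≋-trans (⊗-cong e (≋-refl {const c})) (const-⊗ a (const c))) (≋-refl {F}) ⟩
    const (a ℤ.* c) ⊗ F ∎)
  where
  open ≋-Reasoning
  nz : a ℤ.* c ≢ 0ℤ
  nz z with ℤₚ.i*j≡0⇒i≡0∨j≡0 a z
  ... | inj₁ a≡0 = a≢0 a≡0
  ... | inj₂ c≡0 = c≢0 c≡0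

-- Cyclotomic polynomials

polyQRing : QRing polyRing
polyQRing = record
  { hom          = constHom
  ; q^_          = X^
  ; q^0≈1        = ≋-refl
  ; q^-+         = X^-+
  ; 1-q^-regular = 1-X^-regular
  }

module Q = QSeries polyRing polyQRing
open Q using (1-q^_)

1-q^-∣ : ∀ {g m} → g ∣ m → 1-q^ g ∣ᵖ 1-q^ m
1-q^-∣ {zero}  (divides t refl) = subst (λ i → 1-q^ 0 ∣ᵖ 1-q^ i) (sym (ℕₚ.*-zeroʳ t)) (const 1ℤ , ⊗-identityˡ _)
1-q^-∣ {suc g} (divides t refl) = Q.geom g t , ≋-trans (⊗-comm (Q.geom g t) (1-q^ suc g)) (≋-sym (Q.1-q^cn g t))

-- The exponents d + yn and xm coincide, so `1-q^-+` leaves 1 - q^d from multiples of 1 - q^m and 1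
-- - q^n. The two sign patterns of Bézout's identity in ℕ differ only by exchanging m and n.
1-q^-difference : ∀ {d m n} x y → d ℕ.+ y ℕ.* n ≡ x ℕ.* m →
  ∃[ u ] ∃[ v ] u ⊗ 1-q^ m ⊕ v ⊗ 1-q^ n ≋ 1-q^ d
1-q^-difference {d} {m} {n} x y eq = u , scale -1ℤ (X^ d ⊗ v) , (begin
  u ⊗ M ⊕ scale -1ℤ (X^ d ⊗ v) ⊗ N
    ≈⟨ solve 5 (λ u m d v n → u :* m :+ :- (d :* v) :* n := u :* m :- d :* (v :* n)) ≋-refl u M (X^ d) v N ⟩
  u ⊗ M ⊖ X^ d ⊗ (v ⊗ N)
    ≈⟨ ⊕-cong (≋-trans (_∣ʳ_.equality M∣) (≡⇒≋ (cong 1-q^_ (sym eq))))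
         (scale-cong -1ℤ (⊗-congʳ (X^ d) (_∣ʳ_.equality N∣))) ⟩
  1-q^ (d ℕ.+ y ℕ.* n) ⊖ X^ d ⊗ 1-q^ (y ℕ.* n)
    ≈⟨ Q.1-q^-+ d (y ℕ.* n) ⟩
  1-q^ d ∎)
  where
  open ≋-Reasoning
  M = 1-q^ m
  N = 1-q^ n
  M∣ = 1-q^-∣ {m} {x ℕ.* m} (divides x refl)
  N∣ = 1-q^-∣ {n} {y ℕ.* n} (divides y refl)
  u = _∣ʳ_.quotient M∣
  v = _∣ʳ_.quotient N∣

1-q^-combination : ∀ {d m n} → Bézout.Identity d m n →
  ∃[ u ] ∃[ v ] u ⊗ 1-q^ m ⊕ v ⊗ 1-q^ n ≋ 1-q^ d
1-q^-combination (Bézout.+- x y eq) = 1-q^-difference x y eq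
1-q^-combination {d} {m} {n} (Bézout.-+ x y eq) =
  let u , v , e = 1-q^-difference {d} {n} {m} y x eq
  in v , u , ≋-trans (⊕-comm (v ⊗ 1-q^ m) (u ⊗ 1-q^ n)) e

-- With d = gcd m j, F divides (1-qᵐ)/(1-qᵈ), which is congruent to m/d modulo
-- 1-qᵈ, and 1-qᵈ is a combination of 1-qᵐ and 1-qʲ.
1-q^-⊥ : ∀ {F m j} → 0 < m → ¬ m ∣ j →
  (∀ g → 0 < g → g < m → g ∣ m → F ⊗ 1-q^ g ∣ᵖ 1-q^ m) → 1-q^ j ⊥ F
1-q^-⊥ {F} {suc m} {j} _ m∤j prim with Bézout.lemma (suc m) j
... | Bézout.result zero (GCD.is (divides t eq , _) _) _ = ⊥-elim (ℕₚ.1+n≢0 (trans eq (ℕₚ.*-zeroʳ t)))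
... | Bézout.result (suc g) (GCD.is (g∣m@(divides t eq) , g∣j) _) b =
  -- Solve `geom g t` = t + Gz for t, insert `geom g t` = WF and G = u(1 - qᵐ) + vJ with 1 - qᵐ =
  -- W(FG), and collect the multiples of J and of F.
  coprime {U = scale -1ℤ (z ⊗ v)} {V = W ⊖ z ⊗ u ⊗ (W ⊗ G)} {value = + t} t≢0 (begin
    scale -1ℤ (z ⊗ v) ⊗ J ⊕ (W ⊖ z ⊗ u ⊗ (W ⊗ G)) ⊗ F
      ≈⟨ solve 7 (λ z v J W u G F →
           :- (z :* v) :* J :+ (W :- z :* u :* (W :* G)) :* F
             := W :* F :- z :* (u :* (W :* (F :* G)) :+ v :* J)) ≋-refl z v J W u G F ⟩
    W ⊗ F ⊖ z ⊗ (u ⊗ (W ⊗ (F ⊗ G)) ⊕ v ⊗ J)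
      ≈⟨ ⊕-cong (≋-refl {W ⊗ F}) (scale-cong -1ℤ (⊗-congʳ z (⊕-cong (⊗-congʳ u eW) (≋-refl {v ⊗ J})))) ⟩
    W ⊗ F ⊖ z ⊗ (u ⊗ 1-q^ suc m ⊕ v ⊗ J)
      ≈⟨ ⊕-cong (≋-sym geom≋) (scale-cong -1ℤ (⊗-congʳ z uv)) ⟩
    Q.geom g t ⊖ z ⊗ G
      ≈⟨ ⊕-cong geom∼ (≋-refl {scale -1ℤ (z ⊗ G)}) ⟩
    const (+ t) ⊕ G ⊗ z ⊖ z ⊗ G
      ≈⟨ solve 3 (λ t G z → t :+ G :* z :- z :* G := t) ≋-refl (const (+ t)) G z ⟩
    const (+ t) ∎)
  where
  open ≋-Reasoning
  G = 1-q^ suc g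
  J = 1-q^ j
  t≢0 : + t ≢ 0ℤ
  t≢0 t≡0 = ℕₚ.1+n≢0 (trans eq (cong (ℕ._* suc g) (ℤₚ.+-injective t≡0)))
  g<m : suc g < suc m
  g<m = ℕₚ.≤∧≢⇒< (∣⇒≤ g∣m) λ { refl → m∤j g∣j }
  comb = 1-q^-combination b
  u = proj₁ comb
  v = proj₁ (proj₂ comb)
  uv = proj₂ (proj₂ comb)
  open Q.Modulo G
  z = _∼_.quotient (Q.geom∼c g t)
  geom∼ : Q.geom g t ≋ const (+ t) ⊕ G ⊗ z
  geom∼ = _∼_.equality (Q.geom∼c g t)
  F∣ = prim (suc g) z<s g<m g∣m
  W = _∣ʳ_.quotient F∣
  eW : W ⊗ (F ⊗ G) ≋ 1-q^ suc m
  eW = _∣ʳ_.equality F∣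
  geom≋ : Q.geom g t ≋ W ⊗ F
  geom≋ = Q.1-q^-cancel g (begin
    G ⊗ Q.geom g t        ≈⟨ Q.1-q^cn g t ⟨
    1-q^ (t ℕ.* suc g)    ≡⟨ cong 1-q^_ eq ⟨
    1-q^ suc m            ≈⟨ eW ⟨
    W ⊗ (F ⊗ G)           ≈⟨ solve 3 (λ W F G → W :* (F :* G) := G :* (W :* F)) ≋-refl W F G ⟩
    G ⊗ (W ⊗ F)           ∎)

Ψ : ℕ → Poly
Ψ n = lastPoly (cycList n)

lastPoly-∷ʳ : ∀ xs e → lastPoly (xs ∷ʳ e) ≡ proj₂ e
lastPoly-∷ʳ []           e = refl
lastPoly-∷ʳ (_ ∷ [])     e = refl
lastPoly-∷ʳ (_ ∷ y ∷ xs) e = lastPoly-∷ʳ (y ∷ xs) e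

product : List (ℕ × Poly) → Poly
product = foldr (λ e acc → proj₂ e ⊗ acc) (const 1ℤ)

product-∷ʳ : ∀ xs e → product (xs ∷ʳ e) ≋ product xs ⊗ proj₂ e
product-∷ʳ [] e = ⊗-comm (proj₂ e) (const 1ℤ)
product-∷ʳ (x ∷ xs) e = ≋-trans (⊗-congʳ (proj₂ x) (product-∷ʳ xs e))
  (≋-sym (⊗-assoc (proj₂ x) (product xs) (proj₂ e)))

-- The product of Φ_d over the divisors d ≤ k of n. The bound k is separate so that induction can
-- run along `cycList` with n fixed; at k = n - 1 this is the divisor used in the definition of Φₙ.
∏Ψ : ℕ → ℕ → Poly
∏Ψ n k = product (filter (λ e → proj₁ e ∣? n) (cycList k))

Ψ-suc : ∀ k → Ψ (suc k) ≡ divMonic (3 ℕ.+ k) (X^ (suc k) ⊖ const 1ℤ) (norm (∏Ψ (suc k) k))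
Ψ-suc k = lastPoly-∷ʳ (cycList k) _

filter-cycList : ∀ n k → filter (λ e → proj₁ e ∣? n) (cycList (suc k))
  ≡ filter (λ e → proj₁ e ∣? n) (cycList k) ++ filter (λ e → proj₁ e ∣? n) ((suc k , Ψ (suc k)) ∷ [])
filter-cycList n k = trans
  (cong (λ P → filter (λ e → proj₁ e ∣? n) (cycList k ∷ʳ (suc k , P))) (sym (Ψ-suc k)))
  (Listₚ.filter-++ (λ e → proj₁ e ∣? n) (cycList k) _)

∏Ψ-∣ : ∀ {n k} → suc k ∣ n → ∏Ψ n (suc k) ≋ ∏Ψ n k ⊗ Ψ (suc k)
∏Ψ-∣ {n} {k} k∣n = ≋-trans
  (≡⇒≋ (cong product (trans (filter-cycList n k)
    (cong (filter (λ e → proj₁ e ∣? n) (cycList k) ++_)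
      (Listₚ.filter-accept (λ e → proj₁ e ∣? n) {xs = []} k∣n)))))
  (product-∷ʳ (filter (λ e → proj₁ e ∣? n) (cycList k)) (suc k , Ψ (suc k)))

∏Ψ-∤ : ∀ {n k} → ¬ suc k ∣ n → ∏Ψ n (suc k) ≡ ∏Ψ n k
∏Ψ-∤ {n} {k} k∤n = cong product (trans (filter-cycList n k)
  (trans (cong (filter (λ e → proj₁ e ∣? n) (cycList k) ++_)
      (Listₚ.filter-reject (λ e → proj₁ e ∣? n) {xs = []} k∤n)) (Listₚ.++-identityʳ _)))

∣ᵖ-refl : ∀ {p} → p ∣ᵖ p
∣ᵖ-refl {p} = const 1ℤ , ⊗-identityˡ p

∣ᵖ-respˡ : ∀ {p p′ q} → p ≋ p′ → p ∣ᵖ q → p′ ∣ᵖ q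
∣ᵖ-respˡ e (w , f) = w , ≋-trans (⊗-congʳ w (≋-sym e)) f

∣ᵖ-respʳ : ∀ {p q q′} → q ≋ q′ → p ∣ᵖ q → p ∣ᵖ q′
∣ᵖ-respʳ e (w , f) = w , ≋-trans f e

∏Ψ-mono-∣ : ∀ {g n} k → g ∣ n → ∏Ψ g k ∣ᵖ ∏Ψ n k
∏Ψ-mono-∣ zero    g∣n = ∣ᵖ-refl
∏Ψ-mono-∣ {g} {n} (suc k) g∣n with suc k ∣? g | suc k ∣? n
... | yes k∣g | yes k∣n = ∣ᵖ-respˡ (≋-sym (∏Ψ-∣ k∣g)) (∣ᵖ-respʳ (≋-sym (∏Ψ-∣ k∣n))
                            (∣ᵖ-* (∏Ψ-mono-∣ k g∣n) ∣ᵖ-refl))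
... | yes k∣g | no k∤n  = ⊥-elim (k∤n (∣-trans k∣g g∣n))
... | no k∤g  | yes k∣n = ∣ᵖ-respˡ (≡⇒≋ (sym (∏Ψ-∤ k∤g))) (∣ᵖ-respʳ (≋-sym (∏Ψ-∣ k∣n))
                            (∣ᵖ-trans (∏Ψ-mono-∣ k g∣n) (Ψ (suc k) , ⊗-comm (Ψ (suc k)) (∏Ψ n k))))
... | no k∤g  | no k∤n  = ∣ᵖ-respˡ (≡⇒≋ (sym (∏Ψ-∤ k∤g))) (∣ᵖ-respʳ (≡⇒≋ (sym (∏Ψ-∤ k∤n)))
                            (∏Ψ-mono-∣ k g∣n))

∏Ψ-mono-≤ : ∀ n {j k} → j ≤ k → ∏Ψ n j ∣ᵖ ∏Ψ n k
∏Ψ-mono-≤ n {j} {zero}  z≤n = ∣ᵖ-refl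
∏Ψ-mono-≤ n {j} {suc k} j≤k with ℕₚ.m≤n⇒m<n∨m≡n j≤k
... | inj₂ refl = ∣ᵖ-refl
... | inj₁ (s≤s j≤k′) with suc k ∣? n
...   | yes k∣n = ∣ᵖ-respʳ (≋-sym (∏Ψ-∣ k∣n))
                    (∣ᵖ-trans (∏Ψ-mono-≤ n j≤k′) (Ψ (suc k) , ⊗-comm (Ψ (suc k)) (∏Ψ n k)))
...   | no k∤n  = ∣ᵖ-respʳ (≡⇒≋ (sym (∏Ψ-∤ k∤n))) (∏Ψ-mono-≤ n j≤k′)

1-q^∣X^-1 : ∀ n → 1-q^ n ∣ᵖ X^ n ⊖ const 1ℤ
1-q^∣X^-1 n = const -1ℤ , solve 1 (λ x → con -1ℤ :* (con 1ℤ :- x) := x :- con 1ℤ) ≋-refl (X^ n)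

X^-1∣1-q^ : ∀ n → X^ n ⊖ const 1ℤ ∣ᵖ 1-q^ n
X^-1∣1-q^ n = const -1ℤ , solve 1 (λ x → con -1ℤ :* (x :- con 1ℤ) := con 1ℤ :- x) ≋-refl (X^ n)

record Cyclotomic (n : ℕ) : Set where
  constructor cyclotomic
  field
    factorization : ∏Ψ n n ≋ X^ n ⊖ const 1ℤ
    Ψ-monic       : Monic (Ψ n)
open Cyclotomic

∏Ψ∣1-q^ : ∀ {n} → Cyclotomic n → ∏Ψ n n ∣ᵖ 1-q^ n
∏Ψ∣1-q^ {n} c = ∣ᵖ-respˡ (≋-sym (factorization c)) (X^-1∣1-q^ n)

Ψ∣1-q^ : ∀ {n} → Cyclotomic (suc n) → Ψ (suc n) ∣ᵖ 1-q^ suc n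
Ψ∣1-q^ {n} c = ∣ᵖ-trans (∏Ψ (suc n) n , ≋-sym (∏Ψ-∣ {suc n} {n} ∣-refl)) (∏Ψ∣1-q^ c)

-- All divisors of a proper divisor g are proper divisors of n+1, so 1 - q^g divides the product of
-- the earlier cyclotomic polynomials, which is the cofactor of `Ψ (suc n)`.
Ψ-primitive : ∀ {n} → (∀ m → 0 < m → m ≤ suc n → Cyclotomic m) →
  ∀ g → 0 < g → g < suc n → g ∣ suc n → Ψ (suc n) ⊗ 1-q^ g ∣ᵖ 1-q^ suc n
Ψ-primitive {n} cyc g 0<g (s≤s g≤n) g∣n = ∣ᵖ-trans
  (∣ᵖ-respʳ (≋-trans (⊗-comm (Ψ (suc n)) (∏Ψ (suc n) n)) (≋-sym (∏Ψ-∣ {suc n} {n} ∣-refl)))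
    (∣ᵖ-* {Ψ (suc n)} ∣ᵖ-refl
      (∣ᵖ-trans (1-q^∣X^-1 g)
        (∣ᵖ-trans (∣ᵖ-respˡ (factorization (cyc g 0<g (ℕₚ.m≤n⇒m≤1+n g≤n))) (∏Ψ-mono-∣ g g∣n))
          (∏Ψ-mono-≤ (suc n) g≤n)))))
  (∏Ψ∣1-q^ (cyc (suc n) z<s ℕₚ.≤-refl))

Ψ-⊥ : ∀ {n} → (∀ m → 0 < m → m ≤ suc n → Cyclotomic m) → ∀ {j} → ¬ suc n ∣ j → 1-q^ j ⊥ Ψ (suc n)
Ψ-⊥ cyc n∤j = 1-q^-⊥ z<s n∤j (Ψ-primitive cyc)

-- Each factor Φᵢ with 0 < i ≤ j divides 1 - qⁱ, and j + 1 does not divide i.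
∏Ψ-⊥ : ∀ {j} n → (∀ m → 0 < m → m ≤ suc j → Cyclotomic m) → ∀ i → i ≤ j → ∏Ψ n i ⊥ Ψ (suc j)
∏Ψ-⊥ {j} n cyc zero    i≤j = 1-⊥ (Ψ (suc j))
∏Ψ-⊥ {j} n cyc (suc i) i<j with suc i ∣? n
... | no i∤n  = subst (_⊥ Ψ (suc j)) (sym (∏Ψ-∤ i∤n)) (∏Ψ-⊥ n cyc i (ℕₚ.<⇒≤ i<j))
... | yes i∣n = ⊥-∣ (const 1ℤ , ≋-trans (⊗-identityˡ _) (∏Ψ-∣ i∣n))
  (⊥-⊗ (∏Ψ-⊥ n cyc i (ℕₚ.<⇒≤ i<j))
    (⊥-∣ (Ψ∣1-q^ (cyc (suc i) z<s (ℕₚ.m≤n⇒m≤1+n i<j)))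
      (Ψ-⊥ cyc λ j∣i → ℕₚ.<⇒≱ i<j (ℕ.s≤s⁻¹ (∣⇒≤ j∣i)))))

∏Ψ-monic : ∀ n k → (∀ m → 0 < m → m ≤ k → Cyclotomic m) → Monic (∏Ψ n k)
∏Ψ-monic n zero    cyc = Monic-1
∏Ψ-monic n (suc k) cyc with suc k ∣? n
... | yes k∣n = Monic-resp (≋-sym (∏Ψ-∣ k∣n))
  (Monic-⊗ (∏Ψ-monic n k λ m 0<m m≤k → cyc m 0<m (ℕₚ.m≤n⇒m≤1+n m≤k)) (Ψ-monic (cyc (suc k) z<s ℕₚ.≤-refl)))
... | no k∤n  = subst Monic (sym (∏Ψ-∤ k∤n)) (∏Ψ-monic n k λ m 0<m m≤k → cyc m 0<m (ℕₚ.m≤n⇒m≤1+n m≤k))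

-- The factors are coprime divisors of qⁿ - 1, joined one at a time by `⊥-lcm`; the constant
-- collects the Bézout values.
∏Ψ-∣X^-1 : ∀ n k → (∀ m → 0 < m → m ≤ k → Cyclotomic m) →
  ∃[ c ] c ≢ 0ℤ × ∏Ψ n k ∣ᵖ const c ⊗ (X^ n ⊖ const 1ℤ)
∏Ψ-∣X^-1 n zero cyc = 1ℤ , (λ ()) , const 1ℤ ⊗ (X^ n ⊖ const 1ℤ) ,
  ≋-trans (⊗-comm _ (const 1ℤ)) (⊗-identityˡ _)
∏Ψ-∣X^-1 n (suc k) cyc with ∏Ψ-∣X^-1 n k (λ m 0<m m≤k → cyc m 0<m (ℕₚ.m≤n⇒m≤1+n m≤k)) | suc k ∣? n
... | c , c≢0 , div | no k∤n  = c , c≢0 , ∣ᵖ-respˡ (≡⇒≋ (sym (∏Ψ-∤ k∤n))) div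
... | c , c≢0 , div | yes k∣n =
  let c′ , c′≢0 , div′ = ⊥-lcm (∏Ψ-⊥ n cyc k ℕₚ.≤-refl) c≢0 div
        (∣ᵖ-trans (Ψ∣1-q^ (cyc (suc k) z<s ℕₚ.≤-refl)) (∣ᵖ-trans (1-q^-∣ k∣n) (1-q^∣X^-1 n)))
  in c′ , c′≢0 , ∣ᵖ-respˡ (≋-sym (∏Ψ-∣ k∣n)) div′

-- The earlier factors have a monic product dividing a constant multiple of q^(k+1) - 1, so the long
-- division is exact; the new factor inherits monicity from q^(k+1) - 1.
Cyclotomic-suc : ∀ k → (∀ m → 0 < m → m ≤ k → Cyclotomic m) → Cyclotomic (suc k)
Cyclotomic-suc k cyc = cyclotomic
  (≋-trans (∏Ψ-∣ {suc k} {k} ∣-refl) exact)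
  (Monic-cancel (Ψ (suc k)) D-monic (Monic-resp (≋-sym exact) (Monic-X^-1 k)))
  where
  D = ∏Ψ (suc k) k
  D-monic = ∏Ψ-monic (suc k) k cyc
  div = ∏Ψ-∣X^-1 (suc k) k cyc
  F = X^ (suc k) ⊖ const 1ℤ
  -- The bound obtained is k + 2; the fuel in `cycList` is one more.
  length-F : length (norm F) ≤ 3 ℕ.+ k
  length-F = ℕₚ.m≤n⇒m≤1+n (length-norm F (above (Monic-X^-1 k)))
  exact : D ⊗ Ψ (suc k) ≋ F
  exact = ≋-trans (⊗-comm D (Ψ (suc k))) (subst (λ P → P ⊗ D ≋ F) (sym (Ψ-suc k))
    (divMonic-exact D-monic (3 ℕ.+ k) F (proj₁ div) (proj₁ (proj₂ div)) (proj₂ (proj₂ div)) length-F))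

Cyclotomic-≤ : ∀ k m → 0 < m → m ≤ k → Cyclotomic m
Cyclotomic-≤ zero    m 0<m m≤k = ⊥-elim (ℕₚ.<⇒≱ 0<m m≤k)
Cyclotomic-≤ (suc k) m 0<m m≤k with ℕₚ.m≤n⇒m<n∨m≡n m≤k
... | inj₁ (s≤s m≤k′) = Cyclotomic-≤ k m 0<m m≤k′
... | inj₂ refl       = Cyclotomic-suc k (Cyclotomic-≤ k)

cyclo∣1-q^ : ∀ n → cyclo (suc n) ∣ᵖ 1-q^ suc n
cyclo∣1-q^ n = ∣ᵖ-respˡ (≋-sym (norm-≋ (Ψ (suc n)))) (Ψ∣1-q^ (Cyclotomic-≤ (suc n) (suc n) z<s ℕₚ.≤-refl))

1-q^-⊥-cyclo : ∀ n {j} → ¬ suc n ∣ j → 1-q^ j ⊥ cyclo (suc n)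
1-q^-⊥-cyclo n n∤j = ⊥-sym (⊥-∣ (const 1ℤ , ≋-trans (⊗-identityˡ _) (norm-≋ (Ψ (suc n))))
  (⊥-sym (Ψ-⊥ (Cyclotomic-≤ (suc n)) n∤j)))

-- Rational functions and the congruence

-- Cross-multiplied, because a `RatFun` is an unreduced pair. Both sides of the congruence are in
-- fact polynomials.
Represents : RatFun → Poly → Set
Represents A p = proj₁ A ≋ p ⊗ proj₂ A

Represents-poly : ∀ p → Represents (fromPoly p) p
Represents-poly p = solve 1 (λ p → p := p :* con 1ℤ) ≋-refl p

Represents-⊕ : ∀ {A B p r} → Represents A p → Represents B r → Represents (A +ʳ B) (p ⊕ r)
Represents-⊕ {a , b} {c , d} {p} {r} e f = ≋-trans
  (⊕-cong (⊗-cong e (≋-refl {d})) (⊗-cong f (≋-refl {b})))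
  (solve 4 (λ p b r d → p :* b :* d :+ r :* d :* b := (p :+ r) :* (b :* d)) ≋-refl p b r d)

Represents-⊖ : ∀ {A B p r} → Represents A p → Represents B r → Represents (A -ʳ B) (p ⊖ r)
Represents-⊖ {a , b} {c , d} {p} {r} e f = ≋-trans
  (⊕-cong (⊗-cong e (≋-refl {d})) (scale-cong -1ℤ (⊗-cong f (≋-refl {b}))))
  (solve 4 (λ p b r d → p :* b :* d :- r :* d :* b := (p :- r) :* (b :* d)) ≋-refl p b r d)

Represents-⊗ : ∀ {A B p r} → Represents A p → Represents B r → Represents (A *ʳ B) (p ⊗ r)
Represents-⊗ {a , b} {c , d} {p} {r} e f = ≋-trans (⊗-cong e f)
  (solve 4 (λ p b r d → p :* b :* (r :* d) := p :* r :* (b :* d)) ≋-refl p b r d)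

Represents-sum : ∀ N {f t} → (∀ k → Represents (f k) (t k)) → Represents (sumʳ N f) (Q.sumTo N t)
Represents-sum zero        h = h 0
Represents-sum (suc N) {f} {t} h = Represents-⊕ {sumʳ N f} {f (suc N)} {Q.sumTo N t} {t (suc N)}
  (Represents-sum N {f} {t} h) (h (suc N))

qNum≡fall : ∀ n m → qNum n m ≡ Q.fall n m
qNum≡fall n zero    = refl
qNum≡fall n (suc m) = cong (_⊗ 1-q^ (n ∸ m)) (qNum≡fall n m)

qDen≡fac : ∀ m → qDen m ≡ Q.fac m
qDen≡fac zero    = refl
qDen≡fac (suc m) = cong (_⊗ 1-q^ suc m) (qDen≡fac m)

Represents-qbinom : ∀ n m → Represents (qbinom n m) (Q.gauss n m)
Represents-qbinom n m with m ≤? n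
... | yes _   = ≋-trans (≡⇒≋ (qNum≡fall n m))
  (≋-trans (≋-sym (Q.gauss-fac n m)) (≡⇒≋ (cong (Q.gauss n m ⊗_) (sym (qDen≡fac m)))))
... | no m≰n = ≋-sym (⊗-cong (Q.gauss-> (ℕₚ.≰⇒> m≰n)) (≋-refl {const 1ℤ}))

Represents-truncTri : ∀ a b n → Represents (truncTri a b n) (Q.sumTo (n ℕ./ 2) λ k →
  X^ (k ℕ.* (k ℕ.+ b ℕ.* n)) ⊗ Q.gauss (a ℕ.* n) k ⊗ Q.gauss (a ℕ.* n ∸ k) (b ℕ.* n ℕ.+ k))
Represents-truncTri a b n = Represents-sum (n ℕ./ 2) λ k →
  Represents-⊗
    {fromPoly (X^ (k ℕ.* (k ℕ.+ b ℕ.* n))) *ʳ qbinom (a ℕ.* n) k}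
    {qbinom (a ℕ.* n ∸ k) (b ℕ.* n ℕ.+ k)}
    {X^ (k ℕ.* (k ℕ.+ b ℕ.* n)) ⊗ Q.gauss (a ℕ.* n) k}
    {Q.gauss (a ℕ.* n ∸ k) (b ℕ.* n ℕ.+ k)}
    (Represents-⊗ {fromPoly (X^ (k ℕ.* (k ℕ.+ b ℕ.* n)))} {qbinom (a ℕ.* n) k}
      {X^ (k ℕ.* (k ℕ.+ b ℕ.* n))} {Q.gauss (a ℕ.* n) k}
      (Represents-poly _) (Represents-qbinom (a ℕ.* n) k))
    (Represents-qbinom (a ℕ.* n ∸ k) (b ℕ.* n ℕ.+ k))

Represents-rhs : ∀ a b n → Represents (rhs a b n)
  (Q.gauss (a ℕ.* n) (b ℕ.* n) ⊗ (const 1ℤ ⊖ scale (+ a ℤ.- + b) (const 1ℤ ⊖ theta n)))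
Represents-rhs a b n = Represents-⊗ {qbinom (a ℕ.* n) (b ℕ.* n)} {fromPoly factor}
  {Q.gauss (a ℕ.* n) (b ℕ.* n)} {factor} (Represents-qbinom (a ℕ.* n) (b ℕ.* n)) (Represents-poly factor)
  where factor = const 1ℤ ⊖ scale (+ a ℤ.- + b) (const 1ℤ ⊖ theta n)

-- The exponents of theta are pentagonal numbers

2*pent-suc : ∀ m → pent (suc m) ℕ.* 2 ≡ suc m ℕ.* (3 ℕ.* m ℕ.+ 2)
2*pent-suc zero    = refl
2*pent-suc (suc m) = begin
  (suc (suc m ℕ.* 3) ℕ.+ pent (suc m)) ℕ.* 2
    ≡⟨ ℕₚ.*-distribʳ-+ 2 (suc (suc m ℕ.* 3)) (pent (suc m)) ⟩
  suc (suc m ℕ.* 3) ℕ.* 2 ℕ.+ pent (suc m) ℕ.* 2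
    ≡⟨ cong (suc (suc m ℕ.* 3) ℕ.* 2 ℕ.+_) (2*pent-suc m) ⟩
  suc (suc m ℕ.* 3) ℕ.* 2 ℕ.+ suc m ℕ.* (3 ℕ.* m ℕ.+ 2)
    ≡⟨ S.solve 1 (λ m → let sm = S.con 1 S.:+ m in
         (S.con 1 S.:+ sm S.:* S.con 3) S.:* S.con 2 S.:+ sm S.:* (S.con 3 S.:* m S.:+ S.con 2)
           S.:= (S.con 1 S.:+ sm) S.:* (S.con 3 S.:* sm S.:+ S.con 2)) refl m ⟩
  suc (suc m) ℕ.* (3 ℕ.* suc m ℕ.+ 2) ∎
  where
  open ≡-Reasoning
  module S = +-*-Solver

halve : ∀ {x y} → y ℕ.* 2 ≡ x → x ℕ./ 2 ≡ y
halve {y = y} refl = ℕ/.m*n/n≡m y 2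

pent-3m-1 : ∀ m → (m ℕ.* (3 ℕ.* m ∸ 1)) ℕ./ 2 ≡ pent m
pent-3m-1 zero    = refl
pent-3m-1 (suc m) = halve (trans (2*pent-suc m) (cong (suc m ℕ.*_)
  -- The right side is what `3 * suc m ∸ 1` unfolds to.
  (S.solve 1 (λ m → S.con 3 S.:* m S.:+ S.con 2
      S.:= m S.:+ ((S.con 1 S.:+ m) S.:+ ((S.con 1 S.:+ m) S.:+ S.con 0))) refl m)))
  where module S = +-*-Solver

pent-3m+1 : ∀ m → (m ℕ.* (3 ℕ.* m ℕ.+ 1)) ℕ./ 2 ≡ m ℕ.+ pent m
pent-3m+1 zero    = refl
pent-3m+1 (suc m) = halve {suc m ℕ.* (3 ℕ.* suc m ℕ.+ 1)} {suc m ℕ.+ pent (suc m)}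
  (trans (ℕₚ.*-distribʳ-+ 2 (suc m) (pent (suc m)))
  (trans (cong (suc m ℕ.* 2 ℕ.+_) (2*pent-suc m))
  (S.solve 1 (λ m → let sm = S.con 1 S.:+ m in
    sm S.:* S.con 2 S.:+ sm S.:* (S.con 3 S.:* m S.:+ S.con 2)
      S.:= sm S.:* (S.con 3 S.:* sm S.:+ S.con 1)) refl m)))
  where module S = +-*-Solver

by-exponent : ∀ c (p : ℕ → Poly) {e e′ l} → e ≡ e′ → l ≋ const c ⊗ p e′ → scale c (p e) ≋ l
by-exponent c p {e} refl h = ≋-trans (≋-sym (const-⊗ c (p e))) (≋-sym h)

thetaAux-lucas : ∀ m r → 0 < r ℕ.+ m ℕ.* 3 → r < 3 → thetaAux m r ≋ Q.lucas (r ℕ.+ m ℕ.* 3)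
thetaAux-lucas (suc m) zero _ _ = by-exponent (-1ℤ ℤ.^ suc m)
  (λ e → (const 1ℤ ⊕ X^ (suc m)) ⊗ X^ e) (pent-3m-1 (suc m)) (Q.lucas-3m (suc m) z<s)
thetaAux-lucas m (suc zero) _ _ = by-exponent (-1ℤ ℤ.^ m) X^ (pent-3m+1 m) (Q.lucas-3m+1 m)
thetaAux-lucas m (suc (suc zero)) _ _ = by-exponent (-1ℤ ℤ.^ suc m) X^
  (halve {_} {pent (suc m)} (2*pent-suc m)) (Q.lucas-3m+2 m)
thetaAux-lucas m (suc (suc (suc r))) _ (s≤s (s≤s (s≤s ())))

theta-lucas : ∀ n → 0 < n → theta n ≋ Q.lucas n
theta-lucas n 0<n = subst (λ k → theta n ≋ Q.lucas k) (sym n≡)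
  (thetaAux-lucas (n ℕ./ 3) (n ℕ.% 3) (subst (0 <_) n≡ 0<n) (ℕ/.m%n<n n 3))
  where
  n≡ = ℕ/.m≡m%n+[m/n]*n n 3

-- Divisibility by F² after localising at the polynomials coprime to F. Different multipliers
-- combine by a common denominator, so summands can be treated separately.
record Negligible (F p : Poly) : Set where
  constructor negligible
  field
    {multiplier} : Poly
    ⊥F           : multiplier ⊥ F
    F²∣          : F ⊗ F ∣ᵖ p ⊗ multiplier

Negligible-resp : ∀ {F p p′} → p ≋ p′ → Negligible F p → Negligible F p′
Negligible-resp e (negligible {M} c (w , d)) =
  negligible c (w , ≋-trans d (⊗-cong e (≋-refl {M})))

Negligible-0 : ∀ {F} → Negligible F []
Negligible-0 {F} = negligible (1-⊥ F) ([] , ≋-refl)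

Negligible-+ : ∀ {F p p′} → Negligible F p → Negligible F p′ → Negligible F (p ⊕ p′)
Negligible-+ {F} {p} {p′} (negligible {M} c (w , d)) (negligible {M′} c′ (w′ , d′)) =
  negligible (⊥-⊗ c c′) (w ⊗ M′ ⊕ w′ ⊗ M , (begin
    (w ⊗ M′ ⊕ w′ ⊗ M) ⊗ (F ⊗ F)
      ≈⟨ solve 5 (λ w M′ w′ M F → (w :* M′ :+ w′ :* M) :* (F :* F)
           := w :* (F :* F) :* M′ :+ w′ :* (F :* F) :* M) ≋-refl w M′ w′ M F ⟩
    w ⊗ (F ⊗ F) ⊗ M′ ⊕ w′ ⊗ (F ⊗ F) ⊗ M
      ≈⟨ ⊕-cong (⊗-cong d (≋-refl {M′})) (⊗-cong d′ (≋-refl {M})) ⟩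
    p ⊗ M ⊗ M′ ⊕ p′ ⊗ M′ ⊗ M
      ≈⟨ solve 4 (λ p M M′ p′ → p :* M :* M′ :+ p′ :* M′ :* M := (p :+ p′) :* (M :* M′))
           ≋-refl p M M′ p′ ⟩
    (p ⊕ p′) ⊗ (M ⊗ M′) ∎))
  where open ≋-Reasoning

Negligible⇒CongSq : ∀ {F A B p r} → Represents A p → Represents B r → Negligible F (p ⊖ r) → CongSq F A B
Negligible⇒CongSq {F} {a , b} {c , d} {p} {r} eA eB (negligible {M} M⊥F (w , e)) =
  w , M , ⊥⇒Coprime M⊥F , ≋⇒≈ (begin
    (a ⊗ d ⊖ c ⊗ b) ⊗ M
      ≈⟨ ⊗-cong (Represents-⊖ {a , b} {c , d} {p} {r} eA eB) (≋-refl {M}) ⟩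
    (p ⊖ r) ⊗ E ⊗ M
      ≈⟨ solve 3 (λ x E M → x :* E :* M := x :* M :* E) ≋-refl (p ⊖ r) E M ⟩
    (p ⊖ r) ⊗ M ⊗ E
      ≈⟨ ⊗-cong e (≋-refl {E}) ⟨
    w ⊗ (F ⊗ F) ⊗ E
      ≈⟨ solve 3 (λ w F E → w :* (F :* F) :* E := F :* F :* w :* E) ≋-refl w F E ⟩
    F ⊗ F ⊗ w ⊗ E ∎)
  where
  open ≋-Reasoning
  E = b ⊗ d

-- The congruence modulo the square of Φₙ, summand by summand

module _ (n′ : ℕ) where

  private
    n = suc n′

  fac-⊥ : ∀ m → m < n → Q.fac m ⊥ cyclo n
  fac-⊥ zero    m<n = 1-⊥ (cyclo n)
  fac-⊥ (suc m) m<n = ⊥-⊗ (fac-⊥ m (ℕₚ.<⇒≤ m<n))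
    (1-q^-⊥-cyclo n′ λ n∣m → ℕₚ.<⇒≱ m<n (∣⇒≤ n∣m))

  -- If n divided bn + j it would divide j, but 0 < j < n.
  rise-⊥ : ∀ b m → m < n → Q.rise (b ℕ.* n) m ⊥ cyclo n
  rise-⊥ b zero    m<n = 1-⊥ (cyclo n)
  rise-⊥ b (suc m) m<n = ⊥-⊗ (rise-⊥ b m (ℕₚ.<⇒≤ m<n))
    (1-q^-⊥-cyclo n′ λ n∣ → ℕₚ.<⇒≱ m<n (∣⇒≤ (∣m+n∣m⇒∣n n∣ (n∣m*n b))))

  triTerm-negligible : ∀ b c′ k → suc k ℕ.+ suc k ≤ n →
    let X = b ℕ.* n ; Y = suc c′ ℕ.* n in
    Negligible (cyclo n) (Q.triTerm X Y (suc k)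
      ⊖ const (+ suc c′) ⊗ Q.gauss (X ℕ.+ Y) X ⊗ Q.lucasTerm n (suc k))
  triTerm-negligible b c′ k 2κ≤n =
    negligible (⊥-⊗ (fac-⊥ (suc k) κ<n) (rise-⊥ b (suc k) κ<n))
      (∣ᵖ-trans (∣ᵖ-* (cyclo∣1-q^ n′) (cyclo∣1-q^ n′))
        (proj₁ div , ≋-trans (⊗-comm (proj₁ div) _) (≋-sym (proj₂ div))))
    where
    div = Q.triTerm-lucasTerm n′ b c′ k 2κ≤n
    κ<n : suc k < n
    κ<n = ℕₚ.≤-trans (ℕₚ.+-monoˡ-≤ (suc k) (s≤s z≤n)) 2κ≤n

  truncTri-negligible : ∀ b c′ →
    let X = b ℕ.* n ; Y = suc c′ ℕ.* n in
    Negligible (cyclo n) (Q.sumTo (n ℕ./ 2) (Q.triTerm X Y)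
      ⊖ Q.gauss (X ℕ.+ Y) X ⊗ (const 1ℤ ⊖ const (+ suc c′) ⊗ (const 1ℤ ⊖ Q.lucas n)))
  truncTri-negligible b c′ = Q.sumTo-difference (Negligible (cyclo n))
    Negligible-resp Negligible-0 Negligible-+ (n ℕ./ 2) (const (+ suc c′))
    (Q.gauss (X ℕ.+ Y) X) {Q.triTerm X Y} {Q.lucasTerm n}
    (≋-trans (≡⇒≋ (cong (λ x → const 1ℤ ⊗ const 1ℤ ⊗ Q.gauss (X ℕ.+ Y) x) (ℕₚ.+-identityʳ X)))
             (solve 1 (λ x → con 1ℤ :* con 1ℤ :* x := x) ≋-refl (Q.gauss (X ℕ.+ Y) X)))
    (solve 0 (con 1ℤ :* con 1ℤ :* con 1ℤ := con 1ℤ) ≋-refl)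
    (λ k k<n/2 → triTerm-negligible b c′ k (2κ≤n k<n/2))
    where
    X = b ℕ.* n
    Y = suc c′ ℕ.* n
    2κ≤n : ∀ {k} → k < n ℕ./ 2 → suc k ℕ.+ suc k ≤ n
    2κ≤n {k} lt = ℕₚ.≤-trans (ℕₚ.≤-reflexive (sym (k*2≡k+k (suc k))))
      (ℕₚ.≤-trans (ℕₚ.*-monoˡ-≤ 2 lt) (ℕ/.m/n*n≤m n 2))

theorem1p1 : (a b n : ℕ) → 0 < b → b < a → 0 < n →
    CongSq (cyclo n) (truncTri a b n) (rhs a b n)
theorem1p1 a b (suc n′) 0<b b<a 0<n =
  Negligible⇒CongSq {A = truncTri a b n} {rhs a b n}
    {Q.sumTo (n ℕ./ 2) (t (a ℕ.* n))}
    {Q.gauss (a ℕ.* n) X ⊗ (const 1ℤ ⊖ scale (+ a ℤ.- + b) (const 1ℤ ⊖ theta n))}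
    (Represents-truncTri a b n) (Represents-rhs a b n)
    (Negligible-resp (⊕-cong (≋-refl {Q.sumTo (n ℕ./ 2) (t (a ℕ.* n))}) (scale-cong -1ℤ
        (⊗-congʳ (Q.gauss (a ℕ.* n) X) (⊕-cong (≋-refl {const 1ℤ}) (scale-cong -1ℤ factor≋)))))
      (subst (λ N → Negligible (cyclo n) (Q.sumTo (n ℕ./ 2) (t N)
          ⊖ Q.gauss N X ⊗ (const 1ℤ ⊖ const (+ suc c′) ⊗ (const 1ℤ ⊖ Q.lucas n))))
        (sym an≡) (truncTri-negligible n′ b c′)))
  where
  n = suc n′
  -- The difference a - b is taken in the form `suc c′`: it must be positive for 2k ≤ (a - b)n and
  -- for splitting 1 - q^((a-b)n) off the falling product.
  c′ = a ∸ suc b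
  X = b ℕ.* n
  t : ℕ → ℕ → Poly
  t N k = X^ (k ℕ.* (k ℕ.+ X)) ⊗ Q.gauss N k ⊗ Q.gauss (N ∸ k) (X ℕ.+ k)
  a∸b≡ : a ∸ b ≡ suc c′
  a∸b≡ = ℕₚ.+-∸-assoc 1 b<a
  an≡ : a ℕ.* n ≡ X ℕ.+ suc c′ ℕ.* n
  an≡ = trans (cong (ℕ._* n) (trans (sym (ℕₚ.m+[n∸m]≡n (ℕₚ.<⇒≤ b<a))) (cong (b ℕ.+_) a∸b≡)))
    (ℕₚ.*-distribʳ-+ n b (suc c′))
  a-b≡ : + a ℤ.- + b ≡ + suc c′
  a-b≡ = trans (ℤₚ.m-n≡m⊖n a b) (trans (ℤₚ.⊖-≥ (ℕₚ.<⇒≤ b<a)) (cong +_ a∸b≡))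
  factor≋ : const (+ suc c′) ⊗ (const 1ℤ ⊖ Q.lucas n)
              ≋ scale (+ a ℤ.- + b) (const 1ℤ ⊖ theta n)
  factor≋ = ≋-trans (const-⊗ (+ suc c′) _)
    (≋-trans (≡⇒≋ (cong (λ z → scale z (const 1ℤ ⊖ Q.lucas n)) (sym a-b≡)))
      (scale-cong (+ a ℤ.- + b) (⊕-cong (≋-refl {const 1ℤ}) (scale-cong -1ℤ (≋-sym (theta-lucas n 0<n))))))
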